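{- Let $T=\{2143,2314,2431\}$. Then $$F_T(x)=\frac{1-6x+10x^2-3x^3+x^4}{(1-3x+x^2)(1-4x+2x^2)}.$$
   Context: $S_n(T)$ denotes the set of permutations $\pi$ of $[n]=\{1,\dots,n\}$ (one-line notation) that avoid every pattern $\tau\in T$, i.e. no subsequence of $\pi$ is order-isomorphic to $\tau$. $F_T(x)=\sum_{n\ge 0}|S_n(T)|x^n$, a formal power series, with $|S_0(T)|=1$. -}

module Defs where

open import Data.Fin.Base as Fin using (Fin; toℕ; finToFun; funToFin)
open import Data.Fin.Properties as Fin using (all?; any?; finToFun-funToFin)
open import Data.Integer.Base as ℤ using (ℤ; +_; 0ℤ; 1ℤ)
import Data.Integer.Properties as ℤ
open import Data.List.Base using (List; []; _∷_; length; lookup; filter; allFin)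
open import Data.List.Relation.Unary.All as All using (All)
open import Data.Nat.Base as ℕ using (ℕ; zero; suc; _∸_; _^_)
import Data.Nat.Properties as ℕ
open import Data.Product.Base using (∃; _×_; _,_)
open import Data.Vec.Functional using (Vector)
open import Function.Base using (_∘_)
open import Function.Bundles using (_⇔_; mk⇔; module Equivalence)
open import Function.Consequences.Propositional
  using (strictlySurjective⇒surjective; surjective⇒strictlySurjective)
open import Function.Definitions using (Injective; Surjective; Bijective)
open import Level using (Level)
open import Relation.Binary.Core using (_Preserves_⟶_)
open import Relation.Binary.PropositionalEquality
open import Relation.Nullary.Decidable using (Dec; map′; ¬?; _×-dec_; _→-dec_)
open import Relation.Nullary.Negation using (¬_)
open import Relation.Unary using (Pred; Decidable)

open import Algebra.Properties.Monoid.Sum ℤ.+-0-monoid using (sum⁺-syntax)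

private
  variable
    k m n : ℕ
    ℓ : Level

-- A permutation of [n] is a bijective π : Fin n → Fin n, whose one-line
-- notation is π 0 π 1 … (letters shifted down by one, which does not affect
-- order isomorphism).  A pattern is given by its one-line notation as a list.

IsPermutation : Pred (Fin n → Fin n) _
IsPermutation = Bijective _≡_ _≡_

Pattern : Set
Pattern = List ℕ

OrderIsomorphic : Vector ℕ k → Vector ℕ k → Set
OrderIsomorphic u v = ∀ i j → u i ℕ.< u j ⇔ v i ℕ.< v j

-- ι lists the positions of the occurrence in π.
IsOccurrence : (τ : Pattern) → (Fin n → Fin n) → Pred (Fin (length τ) → Fin n) _
IsOccurrence τ π ι =
  ι Preserves Fin._<_ ⟶ Fin._<_ × OrderIsomorphic (toℕ ∘ π ∘ ι) (lookup τ)

Contains : Pattern → Pred (Fin n → Fin n) _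
Contains τ π = ∃ (IsOccurrence τ π)

S : (n : ℕ) → List Pattern → Pred (Fin n → Fin n) _
S n T π = IsPermutation π × All (λ τ → ¬ Contains τ π) T

private
  _⇔-dec_ : {A B : Set} → Dec A → Dec B → Dec (A ⇔ B)
  a? ⇔-dec b? =
    map′ (λ (f , g) → mk⇔ f g)
         (λ e → Equivalence.to e , Equivalence.from e)
         ((a? →-dec b?) ×-dec (b? →-dec a?))

  anyFun? : {P : Pred (Fin m → Fin n) ℓ} →
            (∀ {f g} → f ≗ g → P f → P g) → Decidable P → Dec (∃ P)
  anyFun? resp P? =
    map′ (λ (i , p) → finToFun i , p)
         (λ (f , p) → funToFin f , resp (sym ∘ finToFun-funToFin f) p)
         (any? (P? ∘ finToFun))

  injective? : Decidable {A = Fin n → Fin n} (Injective _≡_ _≡_)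
  injective? π =
    map′ (λ inj {i} {j} → inj i j) (λ inj i j → inj {i} {j})
         (all? λ i → all? λ j → (π i Fin.≟ π j) →-dec (i Fin.≟ j))

  surjective? : Decidable {A = Fin n → Fin n} (Surjective _≡_ _≡_)
  surjective? π =
    map′ strictlySurjective⇒surjective surjective⇒strictlySurjective
         (all? λ y → any? λ x → π x Fin.≟ y)

isPermutation? : Decidable (IsPermutation {n})
isPermutation? π = injective? π ×-dec surjective? π

isOccurrence? : ∀ τ (π : Fin n → Fin n) → Decidable (IsOccurrence τ π)
isOccurrence? τ π ι =
  map′ (λ inc {i} {j} → inc i j) (λ inc i j → inc {i} {j})
       (all? λ i → all? λ j → (i Fin.<? j) →-dec (ι i Fin.<? ι j))
  ×-dec
  (all? λ i → all? λ j →
    (π (ι i) Fin.<? π (ι j)) ⇔-dec (lookup τ i ℕ.<? lookup τ j))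

isOccurrence-resp : ∀ τ (π : Fin n → Fin n) {ι κ} → ι ≗ κ →
                    IsOccurrence τ π ι → IsOccurrence τ π κ
isOccurrence-resp τ π ι≗κ (inc , iso) =
  (λ {i} {j} i<j → subst₂ Fin._<_ (ι≗κ i) (ι≗κ j) (inc i<j)) ,
  (λ i j → subst₂ (λ a b → toℕ (π a) ℕ.< toℕ (π b) ⇔ lookup τ i ℕ.< lookup τ j)
                  (ι≗κ i) (ι≗κ j) (iso i j))

contains? : ∀ τ → Decidable (Contains {n} τ)
contains? τ π = anyFun? (isOccurrence-resp τ π) (isOccurrence? τ π)

S? : ∀ n T → Decidable (S n T)
S? n T π = isPermutation? π ×-dec All.all? (λ τ → ¬? (contains? τ π)) T

-- finToFun enumerates all functions Fin n → Fin n, each exactly once up to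
-- pointwise equality.
∣S∣ : ℕ → List Pattern → ℕ
∣S∣ n T = length (filter (S? n T ∘ finToFun {n} {n}) (allFin (n ^ n)))

PowerSeries : Set
PowerSeries = ℕ → ℤ

polynomial : List ℤ → PowerSeries
polynomial []       _       = 0ℤ
polynomial (a ∷ _)  zero    = a
polynomial (_ ∷ as) (suc n) = polynomial as n

infixl 7 _*_ _/_

_*_ : PowerSeries → PowerSeries → PowerSeries
(f * g) n = ∑[ i ≤ n ] (f (n ∸ toℕ i) ℤ.* g (toℕ i))

-- Long division by a series q with constant term 1 (meaningless otherwise):
-- p / q = p₀ + x · (remainder p q / q), where remainder p q = (p - p₀ q)/x.
-- By *-/ and /-unique below, p / q is then the unique series f with q * f = p.
remainder : PowerSeries → PowerSeries → PowerSeries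
remainder p q n = p (suc n) ℤ.- q (suc n) ℤ.* p 0

_/_ : PowerSeries → PowerSeries → PowerSeries
(p / q) zero    = p 0
(p / q) (suc n) = (remainder p q / q) n

private
  x+[y-x]≡y : ∀ x y → x ℤ.+ (y ℤ.- x) ≡ y
  x+[y-x]≡y x y = begin
    x ℤ.+ (y ℤ.- x)     ≡⟨ ℤ.+-comm x (y ℤ.- x) ⟩
    y ℤ.- x ℤ.+ x       ≡⟨ ℤ.+-assoc y (ℤ.- x) x ⟩
    y ℤ.+ (ℤ.- x ℤ.+ x) ≡⟨ cong (ℤ._+_ y) (ℤ.+-inverseˡ x) ⟩
    y ℤ.+ 0ℤ            ≡⟨ ℤ.+-identityʳ y ⟩
    y                   ∎
    where open ≡-Reasoning

  x+y-x≡y : ∀ x y → (x ℤ.+ y) ℤ.- x ≡ y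
  x+y-x≡y x y = trans (ℤ.+-assoc x y (ℤ.- x)) (x+[y-x]≡y x y)

  head-* : ∀ q f → q 0 ≡ 1ℤ → (q * f) 0 ≡ f 0
  head-* q f q₀≡1 = begin
    q 0 ℤ.* f 0 ℤ.+ 0ℤ ≡⟨ ℤ.+-identityʳ _ ⟩
    q 0 ℤ.* f 0        ≡⟨ cong (ℤ._* f 0) q₀≡1 ⟩
    1ℤ ℤ.* f 0         ≡⟨ ℤ.*-identityˡ _ ⟩
    f 0                ∎
    where open ≡-Reasoning

*-/ : ∀ p q → q 0 ≡ 1ℤ → q * (p / q) ≗ p
*-/ p q q₀≡1 zero    = head-* q (p / q) q₀≡1
*-/ p q q₀≡1 (suc n) =
  trans (cong (ℤ._+_ (q (suc n) ℤ.* p 0)) (*-/ (remainder p q) q q₀≡1 n))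
        (x+[y-x]≡y (q (suc n) ℤ.* p 0) (p (suc n)))

/-unique : ∀ p q f → q 0 ≡ 1ℤ → q * f ≗ p → f ≗ p / q
/-unique p q f q₀≡1 qf≗p zero    = trans (sym (head-* q f q₀≡1)) (qf≗p 0)
/-unique p q f q₀≡1 qf≗p (suc n) =
  /-unique (remainder p q) q (f ∘ suc) q₀≡1 tail≗ n
  where
  open ≡-Reasoning
  tail≗ : q * (f ∘ suc) ≗ remainder p q
  tail≗ k = begin
    (q * (f ∘ suc)) k
      ≡⟨ x+y-x≡y (q (suc k) ℤ.* f 0) _ ⟨
    (q * f) (suc k) ℤ.- q (suc k) ℤ.* f 0
      ≡⟨ cong₂ (λ a b → a ℤ.- q (suc k) ℤ.* b) (qf≗p (suc k))
               (/-unique p q f q₀≡1 qf≗p 0) ⟩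
    remainder p q k ∎

F : List Pattern → PowerSeries
F T n = + ∣S∣ n T

{-# OPTIONS --safe #-}
-- The patterns are the words 2σ with σ an odd arrangement of 1, 3, 4, that is,
-- a decreasing one in the cyclic order.  Build a word by prepending letters: k
-- may be prepended to w iff, whenever p, q, r are the positions of a letter below
-- k and of two increasing letters not below k, these positions are in cyclic
-- order.  For k ≥ 1 this says that the cyclic word of w contains k, …, n − 1 as a
-- contiguous run, so besides 0 the admissible k form an interval up to n.
-- Prepending a letter changes this interval and the place where the ends of the
-- word cut the run in a way that depends only on these data, which gives a
-- generating tree with four families of labels.  With ρ = (1 − x) / (1 − 2x), the
-- generating functions of its subtrees are linear in the series
-- ρʲ / (1 − 4x + 2x²), apart from the labels of increasing words, where summation
-- of (xρ)ⁱ over i contributes the factor 1 / (1 − xρ) = (1 − 2x) / (1 − 3x + x²).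

module Submission where

open import Defs
open import Data.Integer.Base using (+_; -_)
open import Data.List.Base using (_∷_; [])
open import Relation.Binary.PropositionalEquality using (_≗_)

import Data.Integer.Properties as ℤ
open import Algebra.Properties.Monoid.Sum ℤ.+-0-monoid
  using (sum⁺-syntax; sum-cong-≗; sum-replicate-zero; sum-init-last)
open import Data.Fin.Base as Fin using (Fin; zero; suc; toℕ; finToFun; funToFin)
import Data.Fin.Properties as Fin
open import Data.Integer.Base as ℤ using (ℤ; 0ℤ; 1ℤ; -1ℤ)
open import Data.Integer.Tactic.RingSolver using (solve-∀)
open import Data.List.Base using (List; _++_; map; concatMap; filter; length; iterate; downFrom;
                                  allFin)
open import Data.List.Membership.Propositional using (_∈_; lose)
open import Data.List.Membership.Propositional.Properties using (∈-filter⁺; ∈-allFin)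
open import Data.List.Properties using (filter-accept; filter-all; filter-none; filter-++; length-removeAt′)
open import Data.List.Relation.Unary.All as All using (All; []; _∷_)
import Data.List.Relation.Unary.All.Properties as All
open import Data.List.Relation.Unary.AllPairs as AllPairs using (AllPairs; []; _∷_)
import Data.List.Relation.Unary.AllPairs.Properties as AllPairs
open import Data.List.Relation.Unary.Any as Any using (Any; here; there; _─_; index)
import Data.List.Relation.Unary.Any.Properties as Any
open import Data.List.Relation.Unary.Unique.Propositional using (Unique)
import Data.List.Relation.Unary.Unique.Propositional.Properties as Unique
open import Data.Nat.Base using (ℕ; zero; suc; _+_; _∸_; _^_; _≤_; _<_; z≤n; s≤s; z<s; s<s; s<s⁻¹; s≤s⁻¹)
open import Data.Nat.Properties
open import Data.Product.Base using (∃; _×_; _,_; proj₁; proj₂)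
open import Data.Sum.Base using (_⊎_; inj₁; inj₂)
open import Function.Base using (_∘_)
open import Function.Bundles using (mk⇔; module Equivalence)
open import Function.Consequences.Propositional using (strictlySurjective⇒surjective)
open import Function.Definitions using (Injective)
open import Relation.Binary.Core using (_Preserves_⟶_)
open import Relation.Binary.Definitions using (tri<; tri≈; tri>)
open import Relation.Binary.PropositionalEquality
  using (_≡_; _≢_; refl; sym; trans; cong; cong₂; subst; subst₂; module ≡-Reasoning)
open import Relation.Nullary.Decidable using (yes; no; Dec; _×-dec_; _⊎-dec_; _→-dec_)
open import Relation.Nullary.Negation using (¬_; contradiction)
open import Relation.Unary using (Decidable)

private
  variable
    b d h j k k′ l m n v v′ : ℕ
    A B : Set

-- Relabelling of letters when a new letter is prepended.

bump : ℕ → ℕ → ℕ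
bump zero    v       = suc v
bump (suc b) zero    = zero
bump (suc b) (suc v) = suc (bump b v)

bump-below : v < b → bump b v ≡ v
bump-below {zero}  {suc b} _         = refl
bump-below {suc v} {suc b} (s<s v<b) = cong suc (bump-below v<b)

bump-above : b ≤ v → bump b v ≡ suc v
bump-above {zero}          _         = refl
bump-above {suc b} {suc v} (s≤s b≤v) = cong suc (bump-above b≤v)

bump≤suc : ∀ b v → bump b v ≤ suc v
bump≤suc zero    v       = ≤-refl
bump≤suc (suc b) zero    = z≤n
bump≤suc (suc b) (suc v) = s≤s (bump≤suc b v)

≤bump : ∀ b v → v ≤ bump b v
≤bump zero    v       = n≤1+n v
≤bump (suc b) zero    = z≤n
≤bump (suc b) (suc v) = s≤s (≤bump b v)

bump-mono-< : ∀ b → v < v′ → bump b v < bump b v′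
bump-mono-< zero    v<v′                        = s<s v<v′
bump-mono-< {zero}  {suc v′} (suc b) _          = z<s
bump-mono-< {suc v} {suc v′} (suc b) (s<s v<v′) = s<s (bump-mono-< b v<v′)

bump-cancel-< : ∀ b → bump b v < bump b v′ → v < v′
bump-cancel-< {v} {v′} b lt with <-cmp v v′
... | tri< v<v′ _ _ = v<v′
... | tri≈ _ refl _ = contradiction lt (<-irrefl refl)
... | tri> _ _ v>v′ = contradiction lt (<-asym (bump-mono-< b v>v′))

bump-injective : ∀ b → bump b v ≡ bump b v′ → v ≡ v′
bump-injective {v} {v′} b eq with <-cmp v v′
... | tri< v<v′ _ _ = contradiction eq (<⇒≢ (bump-mono-< b v<v′))
... | tri≈ _ v≡v′ _ = v≡v′
... | tri> _ _ v>v′ = contradiction (sym eq) (<⇒≢ (bump-mono-< b v>v′))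

bump≢ : ∀ b v → bump b v ≢ b
bump≢ (suc b) (suc v) eq = bump≢ b v (suc-injective eq)

unbump : ∀ b v → v ≢ b → ∃ λ v′ → bump b v′ ≡ v
unbump zero    zero    v≢b = contradiction refl v≢b
unbump zero    (suc v) v≢b = v , refl
unbump (suc b) zero    v≢b = zero , refl
unbump (suc b) (suc v) v≢b with unbump b v (v≢b ∘ cong suc)
... | v′ , eq = suc v′ , cong suc eq

-- bump b v lies below the threshold k′ iff v lies below k.
data Threshold (b : ℕ) : ℕ → ℕ → Set where
  below : k ≤ b → Threshold b k k
  above : b ≤ k → Threshold b (suc k) k

bump-< : Threshold b k′ k → v < k → bump b v < k′
bump-< {b} {v = v} (below k≤b) v<k = subst (_< _) (sym (bump-below (<-≤-trans v<k k≤b))) v<k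
bump-< {b} {v = v} (above b≤k) v<k = s≤s (≤-trans (bump≤suc b v) v<k)

bump-<⁻¹ : Threshold b k′ k → bump b v < k′ → v < k
bump-<⁻¹ {b} {v = v} (below k≤b) lt = ≤-<-trans (≤bump b v) lt
bump-<⁻¹ {b} {v = v} (above b≤k) lt with <-≤-connex v b
... | inj₁ v<b = <-≤-trans v<b b≤k
... | inj₂ b≤v = s<s⁻¹ (subst (_< _) (bump-above b≤v) lt)

bump-≥ : Threshold b k′ k → k ≤ v → k′ ≤ bump b v
bump-≥ t k≤v = ≮⇒≥ λ lt → <⇒≱ (bump-<⁻¹ t lt) k≤v

bump-≥⁻¹ : Threshold b k′ k → k′ ≤ bump b v → k ≤ v
bump-≥⁻¹ t k′≤ = ≮⇒≥ λ lt → <⇒≱ (bump-< t lt) k′≤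

-- Words, cyclic order of positions, and sites.

Word : ℕ → Set
Word n = Fin n → ℕ

infixr 5 _◂_

_◂_ : ℕ → Word n → Word (suc n)
(b ◂ w) zero    = b
(b ◂ w) (suc i) = bump b (w i)

CyclicallyOrdered : Fin n → Fin n → Fin n → Set
CyclicallyOrdered p q r =
  (p Fin.< q × q Fin.< r) ⊎ (q Fin.< r × r Fin.< p) ⊎ (r Fin.< p × p Fin.< q)

cyclicallyOrdered? : (p q r : Fin n) → Dec (CyclicallyOrdered p q r)
cyclicallyOrdered? p q r =
  (p Fin.<? q ×-dec q Fin.<? r) ⊎-dec
  ((q Fin.<? r ×-dec r Fin.<? p) ⊎-dec (r Fin.<? p ×-dec p Fin.<? q))

suc-cyclic : {p q r : Fin n} → CyclicallyOrdered p q r →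
             CyclicallyOrdered (suc p) (suc q) (suc r)
suc-cyclic (inj₁ (x , y))        = inj₁ (s<s x , s<s y)
suc-cyclic (inj₂ (inj₁ (x , y))) = inj₂ (inj₁ (s<s x , s<s y))
suc-cyclic (inj₂ (inj₂ (x , y))) = inj₂ (inj₂ (s<s x , s<s y))

suc-cyclic⁻¹ : {p q r : Fin n} → CyclicallyOrdered (suc p) (suc q) (suc r) →
               CyclicallyOrdered p q r
suc-cyclic⁻¹ (inj₁ (x , y))        = inj₁ (s<s⁻¹ x , s<s⁻¹ y)
suc-cyclic⁻¹ (inj₂ (inj₁ (x , y))) = inj₂ (inj₁ (s<s⁻¹ x , s<s⁻¹ y))
suc-cyclic⁻¹ (inj₂ (inj₂ (x , y))) = inj₂ (inj₂ (s<s⁻¹ x , s<s⁻¹ y))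

-- `i` stands for the letter 2 and `p`, `q`, `r` for 1, 3, 4; cyclic order leaves the arrangements
-- 134, 341 and 413.
Avoiding : Word n → Set
Avoiding w = ∀ i p q r → i Fin.< p → i Fin.< q → i Fin.< r →
             w p < w i → w i < w q → w q < w r → CyclicallyOrdered p q r

-- The letter k can be prepended without creating a pattern.
Site : Word n → ℕ → Set
Site w k = ∀ p q r → w p < k → k ≤ w q → w q < w r → CyclicallyOrdered p q r

site? : (w : Word n) → Decidable (Site w)
site? w k = Fin.all? λ p → Fin.all? λ q → Fin.all? λ r →
  (w p <? k) →-dec ((k ≤? w q) →-dec ((w q <? w r) →-dec cyclicallyOrdered? p q r))

Increasing : Word n → ℕ → Set
Increasing w k = ∀ p q → k ≤ w p → w p < w q → p Fin.< q

TopBeforeLow : Word n → ℕ → ℕ → Set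
TopBeforeLow w l k = ∀ p q → l ≤ w p → w q < k → p Fin.< q

LowBeforeMiddle : Word n → ℕ → ℕ → Set
LowBeforeMiddle w k l = ∀ p q → w p < k → k ≤ w q → w q < l → p Fin.< q

increasing-mono : {w : Word n} → k ≤ l → Increasing w k → Increasing w l
increasing-mono k≤l inc p q l≤ = inc p q (≤-trans k≤l l≤)

increasing⇒site : {w : Word n} → Increasing w 0 → Site w k
increasing⇒site inc p q r wp<k k≤wq wq<wr =
  inj₁ (inc p q z≤n (<-≤-trans wp<k k≤wq) , inc q r z≤n wq<wr)

module _ {w : Word n} where

  -- The new first letter is low here. A low letter at the very front turns the cyclic order of `p`,
  -- `q`, `r` into `q` before `r`, which is the extra condition `Increasing w k`.
  site-above : b ≤ k → Site w k → Increasing w k → Site (b ◂ w) (suc k)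
  site-above b≤k g inc p zero r _ k<b _ = contradiction k<b (≤⇒≯ b≤k)
  site-above b≤k g inc p (suc q) zero _ k< <b =
    contradiction (<-trans k< <b) (≤⇒≯ b≤k)
  site-above {b} b≤k g inc zero (suc q) (suc r) _ k≤ lt =
    inj₁ (z<s , s<s (inc q r (bump-≥⁻¹ (above b≤k) k≤) (bump-cancel-< b lt)))
  site-above {b} b≤k g inc (suc p) (suc q) (suc r) p< k≤ lt =
    suc-cyclic (g p q r (bump-<⁻¹ (above b≤k) p<) (bump-≥⁻¹ (above b≤k) k≤) (bump-cancel-< b lt))

  site-above⁻¹ : b ≤ k → Site (b ◂ w) (suc k) → Site w k × Increasing w k
  site-above⁻¹ {b} {k} b≤k g = g′ , inc
    where
    t = above b≤k
    g′ : Site w k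
    g′ p q r p< k≤ lt = suc-cyclic⁻¹
      (g (suc p) (suc q) (suc r) (bump-< t p<) (bump-≥ t k≤) (bump-mono-< b lt))
    inc : Increasing w k
    inc q r k≤ lt with g zero (suc q) (suc r) (s≤s b≤k) (bump-≥ t k≤) (bump-mono-< b lt)
    ... | inj₁ (_ , q<r)        = s<s⁻¹ q<r
    ... | inj₂ (inj₁ (q<r , _)) = s<s⁻¹ q<r

  -- The new first letter is high here. In the role of `q` it requires `r` before `p`, in the role
  -- of `r` it requires `p` before `q`; these are the two extra conditions.
  site-below : k ≤ b → Site w k → TopBeforeLow w b k → LowBeforeMiddle w k b → Site (b ◂ w) k
  site-below k≤b g top mid zero q r b<k _ _ = contradiction b<k (≤⇒≯ k≤b)
  site-below k≤b g top mid (suc p) zero zero _ _ b<b = contradiction b<b (<-irrefl refl)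
  site-below k≤b g top mid (suc p) zero (suc r) p< _ b< =
    inj₂ (inj₁ (z<s , s<s (top r p (bump-≥⁻¹ (above ≤-refl) b<) (bump-<⁻¹ (below k≤b) p<))))
  site-below k≤b g top mid (suc p) (suc q) zero p< k≤ <b =
    inj₂ (inj₂ (z<s , s<s (mid p q (bump-<⁻¹ (below k≤b) p<) (bump-≥⁻¹ (below k≤b) k≤)
                                   (bump-<⁻¹ (below ≤-refl) <b))))
  site-below {b = b} k≤b g top mid (suc p) (suc q) (suc r) p< k≤ lt =
    suc-cyclic (g p q r (bump-<⁻¹ (below k≤b) p<) (bump-≥⁻¹ (below k≤b) k≤) (bump-cancel-< b lt))

  site-below⁻¹ : k ≤ b → Site (b ◂ w) k →
                 Site w k × TopBeforeLow w b k × LowBeforeMiddle w k b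
  site-below⁻¹ {k} {b} k≤b g = g′ , top , mid
    where
    t = below k≤b
    g′ : Site w k
    g′ p q r p< k≤ lt = suc-cyclic⁻¹
      (g (suc p) (suc q) (suc r) (bump-< t p<) (bump-≥ t k≤) (bump-mono-< b lt))
    top : TopBeforeLow w b k
    top r p b≤ p< with g (suc p) zero (suc r) (bump-< t p<) k≤b (bump-≥ (above ≤-refl) b≤)
    ... | inj₂ (inj₁ (_ , r<p)) = s<s⁻¹ r<p
    mid : LowBeforeMiddle w k b
    mid p q p< k≤ <b with g (suc p) (suc q) zero (bump-< t p<) (bump-≥ t k≤) (bump-< (below ≤-refl) <b)
    ... | inj₂ (inj₂ (_ , p<q)) = s<s⁻¹ p<q

  -- The new letter precedes all others, so it can only take the role of `i`, where the condition is
  -- `Site w b`.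
  avoiding-◂ : Avoiding w → Site w b → Avoiding (b ◂ w)
  avoiding-◂ av g zero (suc p) (suc q) (suc r) _ _ _ p< <q lt =
    suc-cyclic (g p q r (bump-<⁻¹ (below ≤-refl) p<) (bump-≥⁻¹ (above ≤-refl) <q) (bump-cancel-< _ lt))
  avoiding-◂ av g (suc i) (suc p) (suc q) (suc r) (s<s i<p) (s<s i<q) (s<s i<r) p< <q lt =
    suc-cyclic (av i p q r i<p i<q i<r (bump-cancel-< _ p<) (bump-cancel-< _ <q) (bump-cancel-< _ lt))

  avoiding-◂⁻¹ : Avoiding (b ◂ w) → Avoiding w × Site w b
  avoiding-◂⁻¹ av =
    (λ i p q r i<p i<q i<r p< <q lt → suc-cyclic⁻¹
       (av (suc i) (suc p) (suc q) (suc r) (s<s i<p) (s<s i<q) (s<s i<r)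
           (bump-mono-< _ p<) (bump-mono-< _ <q) (bump-mono-< _ lt))) ,
    (λ p q r p< b≤ lt → suc-cyclic⁻¹
       (av zero (suc p) (suc q) (suc r) z<s z<s z<s
           (bump-< (below ≤-refl) p<) (bump-≥ (above ≤-refl) b≤) (bump-mono-< _ lt)))

-- Standard words and the states of the generating tree.

record Standard (w : Word n) : Set where
  field
    bounded    : ∀ i → w i < n
    injective  : Injective _≡_ _≡_ w
    surjective : ∀ {v} → v < n → ∃ λ i → w i ≡ v

  position≥ : 0 < n → ∃ λ i → ∀ {v} → v < n → v ≤ w i
  position≥ (s≤s _) with surjective (n<1+n _)
  ... | i , eq = i , λ v<n → ≤-trans (s≤s⁻¹ v<n) (≤-reflexive (sym eq))

open Standard

standard-empty : Standard {0} λ ()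
standard-empty = record { bounded = λ () ; injective = λ { {()} } ; surjective = λ () }

standard-◂ : {w : Word n} → Standard w → b ≤ n → Standard (b ◂ w)
standard-◂ {n} {b} {w} st b≤n = record { bounded = bd ; injective = inj ; surjective = su }
  where
  bd : ∀ i → (b ◂ w) i < suc n
  bd zero    = s≤s b≤n
  bd (suc i) = bump-< (above b≤n) (bounded st i)
  inj : Injective _≡_ _≡_ (b ◂ w)
  inj {zero}  {zero}  _  = refl
  inj {zero}  {suc j} eq = contradiction (sym eq) (bump≢ b (w j))
  inj {suc i} {zero}  eq = contradiction eq (bump≢ b (w i))
  inj {suc i} {suc j} eq = cong suc (injective st (bump-injective b eq))
  su : ∀ {v} → v < suc n → ∃ λ i → (b ◂ w) i ≡ v
  su {v} v<1+n with v ≟ b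
  ... | yes refl = zero , refl
  ... | no  v≢b with unbump b v v≢b
  ... | v′ , refl with surjective st (bump-<⁻¹ (above b≤n) v<1+n)
  ... | i , refl = suc i , refl

-- By the threshold k₀ ≥ 1 the sites are 0, k₀, k₀ + 1, …, n; equivalently the
-- letters k₀, …, n − 1 form a cyclically contiguous increasing run, and k₀ is
-- least with this property.  How the two ends of the word cut the cyclic word
-- decides the threshold of b ◂ w: they are either outside the run (Inner), or
-- directly after it (Final), or inside or directly before it (Split), in which
-- case the word starts with the letters l, …, n − 1.

record Sites (w : Word n) (k₀ : ℕ) : Set where
  field
    good : k₀ ≤ k → Site w k
    bad  : 1 ≤ k → k < k₀ → ¬ Site w k

record Inner (w : Word n) (k₀ : ℕ) : Set where
  field
    sites      : Sites w k₀
    increasing : Increasing w k₀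
    low-first  : ∃ λ p → w p < k₀ × (∀ q → k₀ ≤ w q → p Fin.< q)
    low-last   : ∃ λ p → w p < k₀ × (∀ q → k₀ ≤ w q → q Fin.< p)
  open Sites sites public

record Final (w : Word n) (k₀ : ℕ) : Set where
  field
    sites      : Sites w k₀
    increasing : Increasing w k₀
    low-before : k₀ ≤ k → LowBeforeMiddle w k n
    2≤k₀       : 2 ≤ k₀
  open Sites sites public

record Split (w : Word n) (k₀ l : ℕ) : Set where
  field
    sites      : Sites w k₀
    increasing : Increasing w l
    top-before : TopBeforeLow w l l
    low-before : k₀ ≤ k → LowBeforeMiddle w k l
    1≤k₀       : 1 ≤ k₀
    k₀≤l       : k₀ ≤ l
  open Sites sites public

-- Transitions between the states under prepending.

module _ {w : Word n} (st : Standard w) where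

  site-top : n ≤ k → Site w k
  site-top n≤k p q r _ k≤ _ = contradiction (bounded st q) (≤⇒≯ (≤-trans n≤k k≤))

  increasing-top : n ≤ k → Increasing w k
  increasing-top n≤k p q k≤ _ = contradiction (bounded st p) (≤⇒≯ (≤-trans n≤k k≤))

  topBeforeLow-top : TopBeforeLow w n k
  topBeforeLow-top p q n≤ _ = contradiction (bounded st p) (≤⇒≯ n≤)

  -- For a site k ≤ b the letters ≥ b precede those < k, which precede those
  -- between k and b.
  no-site-below : ∀ {p q} → w p < b → b ≤ w q → p Fin.< q → b < n →
                  1 ≤ k → k ≤ b → ¬ Site (b ◂ w) k
  no-site-below {b} {k} {p} {q} p<b b≤q p<q b<n 1≤k k≤b g
    with site-below⁻¹ k≤b g | surjective st (<-≤-trans 1≤k (≤-trans k≤b (<⇒≤ b<n)))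
  ... | g′ , top , mid | z , wz≡0 with <-≤-connex (w p) k
  ... | inj₁ p<k = <-asym p<q (top q p b≤q p<k)
  -- `z` is the position of the letter 0, which is low for every `k ≥ 1`; the letter at `p` now
  -- counts as middle.
  ... | inj₂ k≤p = <-asym p<q (<-trans (top q z b≤q z<k) (mid z p z<k k≤p p<b))
    where z<k = subst (_< k) (sym wz≡0) 1≤k

  -- As `b ≤ l`, the new letter itself is the low letter in front of the run; the one behind the run
  -- has to come from `w`.
  toInner : b ≤ l → (∀ {k} → l ≤ k → Site w k) → Increasing w l →
            (∃ λ p → w p < l × (∀ q → l ≤ w q → q Fin.< p)) →
            (∀ {k} → 1 ≤ k → k ≤ l → ¬ Site (b ◂ w) k) → Inner (b ◂ w) (suc l)
  toInner {b} {l} b≤l g inc (p , p<l , last) nb = record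
    { sites = record
      { good = λ { (s≤s l≤k) → site-above (≤-trans b≤l l≤k) (g l≤k) (increasing-mono l≤k inc) }
      ; bad  = λ { 1≤k (s<s k≤l) → nb 1≤k k≤l } }
    ; increasing = inc′
    ; low-first  = zero , s≤s b≤l , first′
    ; low-last   = suc p , bump-< t p<l , last′ }
    where
    t = above b≤l
    inc′ : Increasing (b ◂ w) (suc l)
    inc′ zero    _       l< _  = contradiction l< (≤⇒≯ b≤l)
    inc′ (suc p) zero    l< <b = contradiction (<-trans l< <b) (≤⇒≯ b≤l)
    inc′ (suc p) (suc q) l< lt = s<s (inc p q (bump-≥⁻¹ t l<) (bump-cancel-< b lt))
    first′ : ∀ q → suc l ≤ (b ◂ w) q → 0 < toℕ q
    first′ zero    l<b = contradiction l<b (≤⇒≯ b≤l)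
    first′ (suc q) _   = z<s
    last′ : ∀ q → suc l ≤ (b ◂ w) q → q Fin.< suc p
    last′ zero    _  = z<s
    last′ (suc q) l< = s<s (last q (bump-≥⁻¹ t l<))

  -- A low letter in front leaves the run at the end of the word. The bound `1 ≤ l` becomes
  -- `2 ≤ k₀`, which keeps increasing words out of this family.
  toFinal : b ≤ l → (∀ {k} → l ≤ k → Site w k) → Increasing w l →
            (∀ {k} → l ≤ k → LowBeforeMiddle w k n) → 1 ≤ l →
            (∀ {k} → 1 ≤ k → k ≤ l → ¬ Site (b ◂ w) k) → Final (b ◂ w) (suc l)
  toFinal {b} {l} b≤l g inc low 1≤l nb = record
    { sites = record
      { good = λ { (s≤s l≤k) → site-above (≤-trans b≤l l≤k) (g l≤k) (increasing-mono l≤k inc) }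
      ; bad  = λ { 1≤k (s<s k≤l) → nb 1≤k k≤l } }
    ; increasing = inc′
    ; low-before = λ { (s≤s l≤k) → low′ l≤k }
    ; 2≤k₀       = s≤s 1≤l }
    where
    inc′ : Increasing (b ◂ w) (suc l)
    inc′ zero    _       l< _  = contradiction l< (≤⇒≯ b≤l)
    inc′ (suc p) zero    l< <b = contradiction (<-trans l< <b) (≤⇒≯ b≤l)
    inc′ (suc p) (suc q) l< lt = s<s (inc p q (bump-≥⁻¹ (above b≤l) l<) (bump-cancel-< b lt))
    low′ : l ≤ k → LowBeforeMiddle (b ◂ w) (suc k) (suc n)
    low′ l≤k p zero _ k<b _ = contradiction k<b (≤⇒≯ (≤-trans b≤l l≤k))
    low′ l≤k zero (suc q) _ _ _ = z<s
    low′ l≤k (suc p) (suc q) p< k≤ _ =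
      s<s (low l≤k p q (bump-<⁻¹ t p<) (bump-≥⁻¹ t k≤) (bounded st q))
      where t = above (≤-trans b≤l l≤k)

  -- The word `w` starts with `l, …, n − 1` (nothing if `l = n`). The new `l` lengthens this head,
  -- so the threshold of the run does not move.
  toSplit : 1 ≤ k → k ≤ l → (∀ {k′} → k ≤ k′ → Site w k′) → Increasing w l → TopBeforeLow w l l →
            (∀ {k′} → k ≤ k′ → LowBeforeMiddle w k′ l) →
            (∀ {k′} → 1 ≤ k′ → k′ < k → ¬ Site (l ◂ w) k′) → Split (l ◂ w) k l
  toSplit {k₀} {l} 1≤k₀ k₀≤l g inc top low nb = record
    { sites = record { good = g′ ; bad = nb }
    ; increasing = inc′
    ; top-before = top′
    ; low-before = low′
    ; 1≤k₀ = 1≤k₀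
    ; k₀≤l = k₀≤l }
    where
    l≤l : l ≤ l
    l≤l = ≤-refl
    g′ : k₀ ≤ k → Site (l ◂ w) k
    -- The new letter is high for thresholds up to `l` and low for later ones.
    g′ {k} k₀≤k with ≤-<-connex k l
    g′ {k} k₀≤k | inj₁ k≤l =
      site-below k≤l (g k₀≤k) (λ p q l≤ <k → top p q l≤ (<-≤-trans <k k≤l)) (low k₀≤k)
    g′ {suc k} k₀≤k | inj₂ (s≤s l≤k) =
      site-above l≤k (g (≤-trans k₀≤l l≤k)) (increasing-mono l≤k inc)
    inc′ : Increasing (l ◂ w) l
    inc′ zero    zero    _  lt = contradiction lt (<-irrefl refl)
    inc′ zero    (suc q) _  _  = z<s
    inc′ (suc p) zero    l≤ <l = contradiction <l (≤⇒≯ l≤)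
    inc′ (suc p) (suc q) l≤ lt = s<s (inc p q (bump-≥⁻¹ (below l≤l) l≤) (bump-cancel-< l lt))
    top′ : TopBeforeLow (l ◂ w) l l
    top′ p       zero    _  <l = contradiction <l (<-irrefl refl)
    top′ zero    (suc q) _  _  = z<s
    top′ (suc p) (suc q) l≤ <l = s<s (top p q (bump-≥⁻¹ (below l≤l) l≤) (bump-<⁻¹ (below l≤l) <l))
    low′ : k₀ ≤ k → LowBeforeMiddle (l ◂ w) k l
    low′ _ p zero _ _ l<l = contradiction l<l (<-irrefl refl)
    low′ _ zero (suc q) l<k k≤ <l = contradiction (<-≤-trans l<k k≤) (<-asym <l)
    low′ {k} k₀≤k (suc p) (suc q) p< k≤ <l with ≤-<-connex k l
    ... | inj₁ k≤l = s<s (low k₀≤k p q (bump-<⁻¹ (below k≤l) p<) (bump-≥⁻¹ (below k≤l) k≤)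
                              (bump-<⁻¹ (below l≤l) <l))
    ... | inj₂ l<k = contradiction (<-≤-trans l<k k≤) (<-asym <l)

  -- Serves words that do not end with `n − 1`: `n` in front then continues no older run, and both
  -- thresholds are `n`. The hypothesis excludes the smaller sites of `w` that would survive.
  split-top : 1 ≤ n → (∀ {k} → 1 ≤ k → k < n → LowBeforeMiddle w k n → ¬ Site w k) →
              Split (n ◂ w) n n
  split-top 1≤n nb = toSplit 1≤n ≤-refl site-top (increasing-top ≤-refl) topBeforeLow-top
    (λ n≤k p q _ k≤ <n → contradiction <n (≤⇒≯ (≤-trans n≤k k≤)))
    λ 1≤k k<n s → let g , _ , low = site-below⁻¹ (<⇒≤ k<n) s in
      nb 1≤k k<n low g

  module _ (I : Inner w k) (k<n : k < n) where
    open Inner I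

    private
      0<n : 0 < n
      0<n = ≤-<-trans z≤n k<n
      max = proj₁ (position≥ st 0<n)
      ≤max = proj₂ (position≥ st 0<n)

    -- A new letter inside the run leaves only the letters above it contiguous. A low letter
    -- precedes the maximum, so `no-site-below` excludes the sites from 1 to `b`.
    inner-prepend : k ≤ b → b < n → Inner (b ◂ w) (suc b)
    inner-prepend {b} k≤b b<n with low-first | low-last
    ... | p , p<k , first | p′ , p′<k , last = toInner ≤-refl (good ∘ ≤-trans k≤b)
      (increasing-mono k≤b increasing)
      (p′ , <-≤-trans p′<k k≤b , λ q → last q ∘ ≤-trans k≤b)
      (no-site-below (<-≤-trans p<k k≤b) (≤max b<n) (first max (≤max k<n)) b<n)

    inner-prepend-0 : Inner (0 ◂ w) (suc k)
    inner-prepend-0 = toInner z≤n good increasing low-last λ { (s≤s _) → nb }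
      where
      nb : l < k → ¬ Site (0 ◂ w) (suc l)
      -- Threshold 1 would make `w` increasing, against the low letter after the maximum.
      nb {zero} _ s with low-last
      ... | p , p<k , last = <-asym (last max (≤max k<n))
        (proj₂ (site-above⁻¹ z≤n s) p max z≤n (<-≤-trans p<k (≤max k<n)))
      nb {suc l} l<k s = bad z<s l<k (proj₁ (site-above⁻¹ z≤n s))

    inner-prepend-n : Split (n ◂ w) n n
    inner-prepend-n = split-top 0<n nb
      where
      nb : 1 ≤ l → l < n → LowBeforeMiddle w l n → ¬ Site w l
      nb {l} 1≤l l<n low with <-≤-connex l k
      ... | inj₁ l<k = bad 1≤l l<k
      ... | inj₂ k≤l with low-last
      ... | p , p<k , last = λ _ → <-asym (last max (≤max k<n))
        (low p max (<-≤-trans p<k k≤l) (≤max l<n) (bounded st max))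

  module _ (E : Final w k) (k<n : k < n) where
    open Final E

    private
      0<n : 0 < n
      0<n = ≤-<-trans z≤n k<n
      max = proj₁ (position≥ st 0<n)
      ≤max = proj₂ (position≥ st 0<n)
      min = proj₁ (surjective st 0<n)
      min≡0 = proj₂ (surjective st 0<n)
      1≤k : 1 ≤ k
      1≤k = ≤-trans (s≤s z≤n) 2≤k₀
      min< : 1 ≤ b → w min < b
      min< = subst (_< _) (sym min≡0)

    final-prepend : k ≤ b → b < n → Final (b ◂ w) (suc b)
    final-prepend k≤b b<n = toFinal ≤-refl (good ∘ ≤-trans k≤b) (increasing-mono k≤b increasing)
      (low-before ∘ ≤-trans k≤b) (≤-trans 1≤k k≤b)
      (no-site-below (min< (≤-trans 1≤k k≤b)) (≤max b<n)
        (low-before ≤-refl min max (min< 1≤k) (≤max k<n) (bounded st max)) b<n)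

    final-prepend-0 : Final (0 ◂ w) (suc k)
    final-prepend-0 = toFinal z≤n good increasing low-before 1≤k λ { (s≤s _) → nb }
      where
      nb : l < k → ¬ Site (0 ◂ w) (suc l)
      -- Threshold 1 would make `w` increasing, and then 1 would be a site of `w` below `k`.
      nb {zero}  _   s = bad ≤-refl 2≤k₀ (increasing⇒site (proj₂ (site-above⁻¹ z≤n s)))
      nb {suc l} l<k s = bad z<s l<k (proj₁ (site-above⁻¹ z≤n s))

    -- The run ends the word, so cyclically `n` follows `n − 1` and joins it: the threshold stays
    -- `k` and the head is `n` alone.
    final-prepend-n : Split (n ◂ w) k n
    final-prepend-n = toSplit 1≤k (<⇒≤ k<n) good (increasing-top ≤-refl) topBeforeLow-top low-before
      λ 1≤l l<k → bad 1≤l l<k ∘ proj₁ ∘ site-below⁻¹ (<⇒≤ (<-trans l<k k<n))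

  module _ (P : Split w k l) (l<n : l < n) where
    open Split P

    private
      0<n : 0 < n
      0<n = ≤-<-trans z≤n l<n
      max = proj₁ (position≥ st 0<n)
      ≤max = proj₂ (position≥ st 0<n)
      min = proj₁ (surjective st 0<n)
      min≡0 = proj₂ (surjective st 0<n)
      min< : 1 ≤ b → w min < b
      min< = subst (_< _) (sym min≡0)
      1≤l : 1 ≤ l
      1≤l = ≤-trans 1≤k₀ k₀≤l
      max<min : max Fin.< min
      max<min = top-before max min (≤max l<n) (min< 1≤l)

    split-prepend-n : Split (n ◂ w) n n
    split-prepend-n = split-top 0<n λ 1≤b b<n low _ →
      <-asym max<min (low min max (min< 1≤b) (≤max b<n) (bounded st max))

    -- The head letters `l, …, b − 1` become low. Since `l` precedes the maximum, these two
    -- positions exclude the sites from 1 to `b`.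
    split-prepend-top : l < b → b < n → Inner (b ◂ w) (suc b)
    split-prepend-top {b} l<b b<n with surjective st l<n
    ... | p , refl = toInner ≤-refl (good ∘ ≤-trans (≤-trans k₀≤l l≤b)) (increasing-mono l≤b increasing)
      (min , min< (≤-trans 1≤l l≤b) , λ q b≤ → top-before q min (≤-trans l≤b b≤) (min< 1≤l))
      (no-site-below l<b (≤max b<n) (increasing p max ≤-refl (<-≤-trans l<b (≤max b<n))) b<n)
      where l≤b = <⇒≤ l<b

    split-prepend-l : Split (l ◂ w) k l
    split-prepend-l = toSplit 1≤k₀ k₀≤l good increasing top-before low-before
      λ 1≤k l<k → bad 1≤k l<k ∘ proj₁ ∘ site-below⁻¹ (<⇒≤ (<-≤-trans l<k k₀≤l))

    -- The letter `b` separates the head `l, …, n − 1` from the part of the run at the end of the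
    -- word, and only the head stays contiguous.
    split-prepend-low : b ≡ 0 ⊎ k ≤ b → b < l → Inner (b ◂ w) (suc l)
    split-prepend-low {b} b≡0⊎k≤b b<l = toInner (<⇒≤ b<l) (good ∘ ≤-trans k₀≤l) increasing
      (min , min< 1≤l , λ q l≤ → top-before q min l≤ (min< 1≤l)) nb
      where
      -- Such a site would put the letter `m` before the maximum, but `m < l` comes after the head.
      nb-above : b ≤ m → m < l → ¬ Site (b ◂ w) (suc m)
      nb-above b≤m m<l s with surjective st (<-trans m<l l<n)
      ... | p , refl = <-asym (proj₂ (site-above⁻¹ b≤m s) p max ≤-refl (<-≤-trans m<l (≤max l<n)))
                              (top-before max p (≤max l<n) m<l)
      nb-below : b ≡ 0 ⊎ k ≤ b → 1 ≤ m → m ≤ b → ¬ Site (b ◂ w) m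
      nb-below (inj₁ refl) 1≤m m≤0 = contradiction m≤0 (<⇒≱ 1≤m)
      nb-below (inj₂ k≤b) with surjective st (<-trans b<l l<n)
      ... | p , refl = no-site-below (min< (≤-trans 1≤k₀ k≤b)) ≤-refl
        (low-before ≤-refl min p (min< 1≤k₀) k≤b b<l) (<-trans b<l l<n)
      nb : 1 ≤ m → m ≤ l → ¬ Site (b ◂ w) m
      nb {suc m} 1≤m m<l with ≤-<-connex b m
      ... | inj₁ b≤m = nb-above b≤m m<l
      ... | inj₂ m<b = nb-below b≡0⊎k≤b 1≤m m<b

  module _ (inc : Increasing w 0) where

    increasing-sites : Sites w 1
    increasing-sites = record
      { good = λ _ → increasing⇒site inc
      ; bad = λ 1≤k k<1 → contradiction 1≤k (<⇒≱ k<1) }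

    increasing-prepend-0 : Increasing (0 ◂ w) 0
    increasing-prepend-0 zero    (suc q) _ _  = z<s
    increasing-prepend-0 (suc p) (suc q) _ lt = s<s (inc p q z≤n (s<s⁻¹ lt))

    -- Cyclically `n, 0, 1, …, n − 1` is a single run, so the threshold is still 1.
    increasing-prepend-n : 1 ≤ n → Split (n ◂ w) 1 n
    increasing-prepend-n 1≤n = toSplit ≤-refl 1≤n (λ _ → increasing⇒site inc)
      (increasing-top ≤-refl) topBeforeLow-top
      (λ _ p q p< k≤ _ → inc p q z≤n (<-≤-trans p< k≤))
      λ 1≤k k<1 → contradiction 1≤k (<⇒≱ k<1)

    increasing-prepend : 1 ≤ b → b < n → Final (b ◂ w) (suc b)
    increasing-prepend 1≤b b<n with surjective st (≤-<-trans z≤n b<n) | position≥ st (≤-<-trans z≤n b<n)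
    ... | z , wz≡0 | max , ≤max = toFinal ≤-refl (λ _ → increasing⇒site inc)
      (increasing-mono z≤n inc) (λ _ p q p< k≤ _ → inc p q z≤n (<-≤-trans p< k≤)) 1≤b
      (no-site-below z<b (≤max b<n) (inc z max z≤n (<-≤-trans z<b (≤max b<n))) b<n)
      where
      z<b : w z < _
      z<b = subst (_< _) (sym wz≡0) 1≤b

-- Sums over lists, intervals and sites.

∑ : (A → ℤ) → List A → ℤ
∑ f []       = 0ℤ
∑ f (x ∷ xs) = f x ℤ.+ ∑ f xs

∑-++ : (f : A → ℤ) (xs ys : List A) → ∑ f (xs ++ ys) ≡ ∑ f xs ℤ.+ ∑ f ys
∑-++ f []       ys = sym (ℤ.+-identityˡ _)
∑-++ f (x ∷ xs) ys = trans (cong (ℤ._+_ (f x)) (∑-++ f xs ys)) (sym (ℤ.+-assoc (f x) _ _))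

∑-map : (f : B → ℤ) (g : A → B) (xs : List A) → ∑ f (map g xs) ≡ ∑ (f ∘ g) xs
∑-map f g []       = refl
∑-map f g (x ∷ xs) = cong (ℤ._+_ (f (g x))) (∑-map f g xs)

∑-concatMap : (f : B → ℤ) (g : A → List B) (xs : List A) →
              ∑ f (concatMap g xs) ≡ ∑ (∑ f ∘ g) xs
∑-concatMap f g []       = refl
∑-concatMap f g (x ∷ xs) =
  trans (∑-++ f (g x) (concatMap g xs)) (cong (ℤ._+_ (∑ f (g x))) (∑-concatMap f g xs))

∑-cong : {f g : A → ℤ} → f ≗ g → ∑ f ≗ ∑ g
∑-cong f≗g []       = refl
∑-cong f≗g (x ∷ xs) = cong₂ ℤ._+_ (f≗g x) (∑-cong f≗g xs)

∑-1 : (xs : List A) → ∑ (λ _ → 1ℤ) xs ≡ + length xs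
∑-1 []       = refl
∑-1 (x ∷ xs) = cong (ℤ._+_ 1ℤ) (∑-1 xs)

range : ℕ → ℕ → List ℕ
range = iterate suc

range-++ : ∀ k m n → range k (m + n) ≡ range k m ++ range (k + m) n
range-++ k zero    n = cong (λ k → range k n) (sym (+-identityʳ k))
range-++ k (suc m) n = cong (k ∷_)
  (trans (range-++ (suc k) m n) (cong (λ l → range (suc k) m ++ range l n) (sym (+-suc k m))))

∈-range⁺ : k ≤ l → l < k + n → l ∈ range k n
∈-range⁺ {k} {l} {zero}  k≤l l<k+n =
  contradiction (subst (l <_) (+-identityʳ k) l<k+n) (≤⇒≯ k≤l)
∈-range⁺ {k} {l} {suc n} k≤l l<k+n with m≤n⇒m<n∨m≡n k≤l
... | inj₁ k<l  = there (∈-range⁺ k<l (subst (l <_) (+-suc k n) l<k+n))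
... | inj₂ refl = here refl

∈-range⁻ : ∀ k n → All (λ l → k ≤ l × l < k + n) (range k n)
∈-range⁻ k zero    = []
∈-range⁻ k (suc n) = (≤-refl , subst (k <_) (sym (+-suc k n)) (s≤s (m≤m+n k n)))
  ∷ All.map (λ { {l} (k<l , lt) → <⇒≤ k<l , subst (l <_) (sym (+-suc k n)) lt }) (∈-range⁻ (suc k) n)

range-unique : ∀ k n → Unique (range k n)
range-unique k zero    = []
range-unique k (suc n) =
  All.map (λ (k<l , _) → <⇒≢ k<l) (∈-range⁻ (suc k) n) ∷ range-unique (suc k) n

∑-range-const : ∀ (f : ℕ → ℤ) x k n → (∀ {b} → k ≤ b → b < k + n → f b ≡ x) →
                ∑ f (range k n) ≡ + n ℤ.* x
∑-range-const f x k zero    eq = sym (ℤ.*-zeroˡ x)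
∑-range-const f x k (suc n) eq = trans
  (cong₂ ℤ._+_ (eq ≤-refl (m<m+n k z<s))
    (∑-range-const f x (suc k) n λ {b} k<b lt → eq (<⇒≤ k<b) (subst (b <_) (sym (+-suc k n)) lt)))
  (sym (ℤ.suc-* (+ n) x))

-- Labels are indexed from the top by `h = n − b − 1`, so ascending letters run through descending
-- indices.
∑-range-reverse : ∀ (f g : ℕ → ℤ) k m n → k + m ≡ n →
                  (∀ {b h} → k ≤ b → b + suc h ≡ n → f b ≡ g h) →
                  ∑ f (range k m) ≡ ∑ g (downFrom m)
∑-range-reverse f g k zero    n _  _  = refl
∑-range-reverse f g k (suc m) n eq fg = cong₂ ℤ._+_ (fg ≤-refl eq)
  (∑-range-reverse f g (suc k) m n (trans (sym (+-suc k m)) eq) (fg ∘ <⇒≤))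

∑-sites : {w : Word n} (f : ℕ → ℤ) → Sites w (suc k) → suc k + m ≡ n →
          ∑ f (filter (site? w) (range 0 (suc n))) ≡ f 0 ℤ.+ (∑ f (range (suc k) m) ℤ.+ f n)
∑-sites {n} {k} {m} {w} f st eq = begin
  ∑ f (filter (site? w) (range 0 (suc n)))
    -- 0 is always a site, as no letter lies below it.
    ≡⟨ cong (∑ f) (filter-accept (site? w) λ _ _ _ ()) ⟩
  f 0 ℤ.+ ∑ f (filter (site? w) (range 1 n))
    ≡⟨ cong (λ xs → f 0 ℤ.+ ∑ f xs) filtered ⟩
  f 0 ℤ.+ ∑ f (range (suc k) m ++ n ∷ [])
    ≡⟨ cong (ℤ._+_ (f 0)) (∑-++ f (range (suc k) m) (n ∷ [])) ⟩
  f 0 ℤ.+ (∑ f (range (suc k) m) ℤ.+ (f n ℤ.+ 0ℤ))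
    ≡⟨ cong (λ x → f 0 ℤ.+ (∑ f (range (suc k) m) ℤ.+ x)) (ℤ.+-identityʳ (f n)) ⟩
  f 0 ℤ.+ (∑ f (range (suc k) m) ℤ.+ f n) ∎
  where
  open ≡-Reasoning
  open Sites st
  split : range 1 n ≡ range 1 k ++ (range (suc k) m ++ n ∷ [])
  split = begin
    range 1 n                               ≡⟨ cong (range 1) (sym eq) ⟩
    range 1 (suc k + m)                     ≡⟨ cong (range 1)
                                                 (trans (cong (_+_ k) (+-comm m 1)) (+-suc k m)) ⟨
    range 1 (k + (m + 1))                   ≡⟨ range-++ 1 k (m + 1) ⟩
    range 1 k ++ range (suc k) (m + 1)      ≡⟨ cong (range 1 k ++_) (range-++ (suc k) m 1) ⟩
    range 1 k ++ (range (suc k) m ++ (suc k + m) ∷ [])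
      ≡⟨ cong (λ l → range 1 k ++ (range (suc k) m ++ l ∷ [])) eq ⟩
    range 1 k ++ (range (suc k) m ++ n ∷ []) ∎
  filtered : filter (site? w) (range 1 n) ≡ range (suc k) m ++ n ∷ []
  filtered = begin
    filter (site? w) (range 1 n)
      ≡⟨ cong (filter (site? w)) split ⟩
    filter (site? w) (range 1 k ++ (range (suc k) m ++ n ∷ []))
      ≡⟨ filter-++ (site? w) (range 1 k) _ ⟩
    filter (site? w) (range 1 k) ++ filter (site? w) (range (suc k) m ++ n ∷ [])
      ≡⟨ cong₂ _++_
           (filter-none (site? w) (All.map (λ (1≤l , l<k) → bad 1≤l l<k) (∈-range⁻ 1 k)))
           (filter-all (site? w) (All.++⁺ (All.map (good ∘ proj₁) (∈-range⁻ (suc k) m))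
                                          (good (m+n≤o⇒m≤o (suc k) (≤-reflexive eq)) ∷ []))) ⟩
    range (suc k) m ++ n ∷ [] ∎

-- Generating functions of the labels and their recurrences.

-- s j = ρʲ / (1 − 4x + 2x²) with ρ = (1 − x) / (1 − 2x).

s : ℕ → ℕ → ℤ
s zero    zero          = + 1
s zero    (suc zero)    = + 4
s zero    (suc (suc m)) = + 4 ℤ.* s zero (suc m) ℤ.- + 2 ℤ.* s zero m
s (suc j) zero          = + 1
s (suc j) (suc m)       = + 2 ℤ.* s (suc j) m ℤ.+ (s j (suc m) ℤ.- s j m)

-- t k = s k + x s (k + 1) + x² s (k + 2) + …
t : ℕ → ℕ → ℤ
t k zero    = + 1
t k (suc m) = s k (suc m) ℤ.+ t (suc k) m

infixr 8 x·_

x·_ : (ℕ → ℤ) → ℕ → ℤ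
(x· f) zero    = 0ℤ
(x· f) (suc m) = f m

-- The numbers of descendants after m steps; for a word of length n and state
-- Inner k₀ or Final k₀ the index is h = n − k₀ − 1, for Split k₀ l the indices are
-- d = l − k₀ and j = n − l − 1, and identity k belongs to length k + 1.

inner : ℕ → ℕ → ℤ
inner h m = s h m ℤ.- (x· s (suc h)) m

split : ℕ → ℕ → ℕ → ℤ
split d j m = s j m ℤ.+ (+ d ℤ.- 1ℤ) ℤ.* (x· s j) m

final : ℕ → ℕ → ℤ
final h m = s h m ℤ.- (x· s 0) m

identity : ℕ → ℕ → ℤ
identity k m = t k m ℤ.- + 2 ℤ.* (x· t k) m ℤ.- (x· s 0) m

s-zero : ∀ j → s j 0 ≡ 1ℤ
s-zero zero    = refl
s-zero (suc j) = refl

s0-suc : ∀ m → s 0 (suc m) ≡ + 4 ℤ.* s 0 m ℤ.- + 2 ℤ.* (x· s 0) m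
s0-suc zero    = refl
s0-suc (suc m) = refl

-- This is `(1 − 2x) s (suc j) = (1 − x) s j`; with `x·_` it includes the constant coefficient.
s-suc : ∀ j m → s (suc j) m ≡ + 2 ℤ.* (x· s (suc j)) m ℤ.+ (s j m ℤ.- (x· s j) m)
s-suc j zero    rewrite s-zero j = refl
s-suc j (suc m) = refl

t-shift : ∀ k m → t k m ≡ s k m ℤ.+ (x· t (suc k)) m
t-shift k zero    rewrite s-zero k = refl
t-shift k (suc m) = refl

-- Multiplication by `ρ` takes `t k` to `t (suc k)` termwise, so the relation between `s k` and
-- `s (suc k)` carries over.
t-suc : ∀ k m → t (suc k) m ≡ + 2 ℤ.* (x· t (suc k)) m ℤ.+ (t k m ℤ.- (x· t k) m)
t-suc k zero    = refl
t-suc k (suc m) = begin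
  s (suc k) (suc m) ℤ.+ t (suc (suc k)) m
    ≡⟨ cong (ℤ._+_ (s (suc k) (suc m))) (t-suc (suc k) m) ⟩
  + 2 ℤ.* s (suc k) m ℤ.+ (s k (suc m) ℤ.- s k m) ℤ.+
    (+ 2 ℤ.* (x· t (suc (suc k))) m ℤ.+ (t (suc k) m ℤ.- (x· t (suc k)) m))
    ≡⟨ regroup (s (suc k) m) (s k (suc m)) (s k m) ((x· t (suc (suc k))) m)
               (t (suc k) m) ((x· t (suc k)) m) ⟩
  + 2 ℤ.* (s (suc k) m ℤ.+ (x· t (suc (suc k))) m) ℤ.+
    (s k (suc m) ℤ.+ t (suc k) m ℤ.- (s k m ℤ.+ (x· t (suc k)) m))
    ≡⟨ cong₂ (λ x y → + 2 ℤ.* x ℤ.+ (s k (suc m) ℤ.+ t (suc k) m ℤ.- y))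
             (sym (t-shift (suc k) m)) (sym (t-shift k m)) ⟩
  + 2 ℤ.* t (suc k) m ℤ.+ (t k (suc m) ℤ.- t k m) ∎
  where
  open ≡-Reasoning
  regroup : ∀ a b c d e f → + 2 ℤ.* a ℤ.+ (b ℤ.- c) ℤ.+ (+ 2 ℤ.* d ℤ.+ (e ℤ.- f)) ≡
            + 2 ℤ.* (a ℤ.+ d) ℤ.+ (b ℤ.+ e ℤ.- (c ℤ.+ f))
  regroup = solve-∀

-- Induction on `h`: the right-hand side grows by `inner (suc h) m` because of `s-suc`. The factor
-- `1 − 4x + 2x²` enters only in the base case, through `s0-suc`.
∑-inner : ∀ h m → ∑ (λ h → inner h m) (downFrom (suc h)) ≡
                  inner h (suc m) ℤ.- inner h m ℤ.- split 0 0 m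
∑-inner zero m = begin
  s 0 m ℤ.- (x· s 1) m ℤ.+ 0ℤ
    ≡⟨ eq₀ (s 0 m) ((x· s 1) m) ((x· s 0) m) ⟩
  (+ 4 ℤ.* s 0 m ℤ.- + 2 ℤ.* (x· s 0) m) ℤ.- (+ 2 ℤ.* (x· s 1) m ℤ.+ (s 0 m ℤ.- (x· s 0) m))
    ℤ.- (s 0 m ℤ.- (x· s 1) m) ℤ.- (s 0 m ℤ.+ -1ℤ ℤ.* (x· s 0) m)
    ≡⟨ cong₂ (λ x y → x ℤ.- y ℤ.- (s 0 m ℤ.- (x· s 1) m) ℤ.- (s 0 m ℤ.+ -1ℤ ℤ.* (x· s 0) m))
             (sym (s0-suc m)) (sym (s-suc 0 m)) ⟩
  s 0 (suc m) ℤ.- s 1 m ℤ.- (s 0 m ℤ.- (x· s 1) m) ℤ.- (s 0 m ℤ.+ -1ℤ ℤ.* (x· s 0) m) ∎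
  where
  open ≡-Reasoning
  eq₀ : ∀ a b c → a ℤ.- b ℤ.+ 0ℤ ≡ (+ 4 ℤ.* a ℤ.- + 2 ℤ.* c) ℤ.- (+ 2 ℤ.* b ℤ.+ (a ℤ.- c))
          ℤ.- (a ℤ.- b) ℤ.- (a ℤ.+ -1ℤ ℤ.* c)
  eq₀ = solve-∀
∑-inner (suc h) m = begin
  inner (suc h) m ℤ.+ ∑ (λ h → inner h m) (downFrom (suc h))
    ≡⟨ cong (ℤ._+_ (inner (suc h) m)) (∑-inner h m) ⟩
  s (suc h) m ℤ.- (x· s (2 + h)) m ℤ.+
    (s h (suc m) ℤ.- s (suc h) m ℤ.- (s h m ℤ.- (x· s (suc h)) m) ℤ.- split 0 0 m)
    ≡⟨ eq₁ (s (suc h) m) ((x· s (2 + h)) m) (s h (suc m)) (s h m) ((x· s (suc h)) m) (split 0 0 m) ⟩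
  + 2 ℤ.* s (suc h) m ℤ.+ (s h (suc m) ℤ.- s h m) ℤ.-
    (+ 2 ℤ.* (x· s (2 + h)) m ℤ.+ (s (suc h) m ℤ.- (x· s (suc h)) m)) ℤ.-
    (s (suc h) m ℤ.- (x· s (2 + h)) m) ℤ.- split 0 0 m
    ≡⟨ cong (λ x → s (suc h) (suc m) ℤ.- x ℤ.- inner (suc h) m ℤ.- split 0 0 m) (sym (s-suc (suc h) m)) ⟩
  inner (suc h) (suc m) ℤ.- inner (suc h) m ℤ.- split 0 0 m ∎
  where
  open ≡-Reasoning
  eq₁ : ∀ a b c d e f → a ℤ.- b ℤ.+ (c ℤ.- a ℤ.- (d ℤ.- e) ℤ.- f) ≡
          + 2 ℤ.* a ℤ.+ (c ℤ.- d) ℤ.- (+ 2 ℤ.* b ℤ.+ (a ℤ.- e)) ℤ.- (a ℤ.- b) ℤ.- f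
  eq₁ = solve-∀

-- The children: 0 keeps `h`, the letters of the run give `h, …, 0`, and `n` gives `split 0 0`.
inner-rec : ∀ h m →
  inner h m ℤ.+ (∑ (λ h → inner h m) (downFrom (suc h)) ℤ.+ split 0 0 m) ≡ inner h (suc m)
inner-rec h m rewrite ∑-inner h m = eq (inner h m) (inner h (suc m)) (split 0 0 m)
  where
  eq : ∀ a b c → a ℤ.+ (b ℤ.- a ℤ.- c ℤ.+ c) ≡ b
  eq = solve-∀

-- The children: 0 and the `d` letters below `l` give `inner j`, the letter `l` itself gives
-- `split d (suc j)`, the letters above it `inner` at `j − 1, …, 0`, and `n` gives `split 0 0`.
split-rec : ∀ d j m →
  inner j m ℤ.+ ((+ d ℤ.* inner j m ℤ.+
    (split d (suc j) m ℤ.+ ∑ (λ h → inner h m) (downFrom j))) ℤ.+ split 0 0 m)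
  ≡ split d j (suc m)
split-rec d j m = begin
  inner j m ℤ.+ ((+ d ℤ.* inner j m ℤ.+ (split d (suc j) m ℤ.+ σ)) ℤ.+ split 0 0 m)
    ≡⟨ eq₀ (inner j m) (+ d) (split d (suc j) m) σ (split 0 0 m) ⟩
  (inner j m ℤ.+ σ ℤ.+ split 0 0 m) ℤ.+ + d ℤ.* inner j m ℤ.+ split d (suc j) m
    ≡⟨ cong (λ x → (x ℤ.+ split 0 0 m) ℤ.+ + d ℤ.* inner j m ℤ.+ split d (suc j) m) (∑-inner j m) ⟩
  (inner j (suc m) ℤ.- inner j m ℤ.- split 0 0 m ℤ.+ split 0 0 m) ℤ.+ + d ℤ.* inner j m ℤ.+ split d (suc j) m
    ≡⟨ eq₁ (s j (suc m)) (s (suc j) m) (s j m) ((x· s (suc j)) m) (split 0 0 m) (+ d) ⟩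
  split d j (suc m) ∎
  where
  open ≡-Reasoning
  σ = ∑ (λ h → inner h m) (downFrom j)
  eq₀ : ∀ a d b c e → a ℤ.+ ((d ℤ.* a ℤ.+ (b ℤ.+ c)) ℤ.+ e) ≡ (a ℤ.+ c ℤ.+ e) ℤ.+ d ℤ.* a ℤ.+ b
  eq₀ = solve-∀
  eq₁ : ∀ a b c e f d → (a ℤ.- b ℤ.- (c ℤ.- e) ℤ.- f ℤ.+ f) ℤ.+ d ℤ.* (c ℤ.- e) ℤ.+ (b ℤ.+ (d ℤ.- 1ℤ) ℤ.* e) ≡
        a ℤ.+ (d ℤ.- 1ℤ) ℤ.* c
  eq₁ = solve-∀

-- As for `∑-inner`, but the index of `split` grows with `h`; the term `x· s 0` in `final`
-- compensates for that.
∑-final : ∀ h m → ∑ (λ h → final h m) (downFrom (suc h)) ≡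
          final h (suc m) ℤ.- final h m ℤ.- split (suc h) 0 m
∑-final zero m = begin
  s 0 m ℤ.- (x· s 0) m ℤ.+ 0ℤ
    ≡⟨ eq₀ (s 0 m) ((x· s 0) m) ⟩
  (+ 4 ℤ.* s 0 m ℤ.- + 2 ℤ.* (x· s 0) m) ℤ.- s 0 m ℤ.- (s 0 m ℤ.- (x· s 0) m) ℤ.- (s 0 m ℤ.+ 0ℤ ℤ.* (x· s 0) m)
    ≡⟨ cong (λ x → x ℤ.- s 0 m ℤ.- (s 0 m ℤ.- (x· s 0) m) ℤ.- (s 0 m ℤ.+ 0ℤ ℤ.* (x· s 0) m)) (sym (s0-suc m)) ⟩
  final 0 (suc m) ℤ.- final 0 m ℤ.- split 1 0 m ∎
  where
  open ≡-Reasoning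
  eq₀ : ∀ a b → a ℤ.- b ℤ.+ 0ℤ ≡ (+ 4 ℤ.* a ℤ.- + 2 ℤ.* b) ℤ.- a ℤ.- (a ℤ.- b) ℤ.- (a ℤ.+ 0ℤ ℤ.* b)
  eq₀ = solve-∀
∑-final (suc h) m = begin
  final (suc h) m ℤ.+ ∑ (λ h → final h m) (downFrom (suc h))
    ≡⟨ cong (ℤ._+_ (final (suc h) m)) (∑-final h m) ⟩
  final (suc h) m ℤ.+ (final h (suc m) ℤ.- final h m ℤ.- split (suc h) 0 m)
    ≡⟨ eq₁ (s (suc h) m) (s h (suc m)) (s h m) (s 0 m) ((x· s 0) m) (+ h) ⟩
  final (suc h) (suc m) ℤ.- final (suc h) m ℤ.- split (2 + h) 0 m ∎
  where
  open ≡-Reasoning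
  eq₁ : ∀ a b c d e h → (a ℤ.- e) ℤ.+ ((b ℤ.- d) ℤ.- (c ℤ.- e) ℤ.- (d ℤ.+ (1ℤ ℤ.+ h ℤ.- 1ℤ) ℤ.* e)) ≡
        (+ 2 ℤ.* a ℤ.+ (b ℤ.- c) ℤ.- d) ℤ.- (a ℤ.- e) ℤ.- (d ℤ.+ (+ 2 ℤ.+ h ℤ.- 1ℤ) ℤ.* e)
  eq₁ = solve-∀

final-rec : ∀ h m →
  final h m ℤ.+ (∑ (λ h → final h m) (downFrom (suc h)) ℤ.+ split (suc h) 0 m) ≡ final h (suc m)
final-rec h m rewrite ∑-final h m = eq (final h m) (final h (suc m)) (split (suc h) 0 m)
  where
  eq : ∀ a b c → a ℤ.+ (b ℤ.- a ℤ.- c ℤ.+ c) ≡ b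
  eq = solve-∀

-- The child at 0 is again increasing, which is why `identity` involves the infinite sum `t`;
-- `t-shift` peels off its first term.
identity-rec : ∀ k m →
  identity (suc k) m ℤ.+ (∑ (λ h → final h m) (downFrom k) ℤ.+ split k 0 m) ≡ identity k (suc m)
identity-rec zero m = begin
  identity 1 m ℤ.+ (0ℤ ℤ.+ split 0 0 m)
    ≡⟨ eq₀ (t 1 m) ((x· t 1) m) ((x· s 0) m) (s 0 m) ⟩
  (+ 4 ℤ.* s 0 m ℤ.- + 2 ℤ.* (x· s 0) m ℤ.+ t 1 m) ℤ.- + 2 ℤ.* (s 0 m ℤ.+ (x· t 1) m) ℤ.- s 0 m
    ≡⟨ cong₂ (λ x y → (x ℤ.+ t 1 m) ℤ.- + 2 ℤ.* y ℤ.- s 0 m) (sym (s0-suc m)) (sym (t-shift 0 m)) ⟩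
  identity 0 (suc m) ∎
  where
  open ≡-Reasoning
  eq₀ : ∀ a b c d → a ℤ.- + 2 ℤ.* b ℤ.- c ℤ.+ (0ℤ ℤ.+ (d ℤ.+ -1ℤ ℤ.* c)) ≡
        (+ 4 ℤ.* d ℤ.- + 2 ℤ.* c ℤ.+ a) ℤ.- + 2 ℤ.* (d ℤ.+ b) ℤ.- d
  eq₀ = solve-∀
identity-rec (suc k) m = begin
  identity (2 + k) m ℤ.+ (∑ (λ h → final h m) (downFrom (suc k)) ℤ.+ split (suc k) 0 m)
    ≡⟨ cong (λ x → identity (2 + k) m ℤ.+ (x ℤ.+ split (suc k) 0 m)) (∑-final k m) ⟩
  identity (2 + k) m ℤ.+ (final k (suc m) ℤ.- final k m ℤ.- split (suc k) 0 m ℤ.+ split (suc k) 0 m)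
    ≡⟨ eq₁ (t (2 + k) m) ((x· t (2 + k)) m) ((x· s 0) m) (s k (suc m))
           (s 0 m) (s k m) (split (suc k) 0 m) (s (suc k) m) ⟩
  (s (suc k) (suc m) ℤ.+ t (2 + k) m) ℤ.- + 2 ℤ.* (s (suc k) m ℤ.+ (x· t (2 + k)) m) ℤ.- s 0 m
    ≡⟨ cong (λ x → (s (suc k) (suc m) ℤ.+ t (2 + k) m) ℤ.- + 2 ℤ.* x ℤ.- s 0 m) (sym (t-shift (suc k) m)) ⟩
  identity (suc k) (suc m) ∎
  where
  open ≡-Reasoning
  eq₁ : ∀ a b c d e f g h → a ℤ.- + 2 ℤ.* b ℤ.- c ℤ.+ (d ℤ.- e ℤ.- (f ℤ.- c) ℤ.- g ℤ.+ g) ≡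
        (+ 2 ℤ.* h ℤ.+ (d ℤ.- f) ℤ.+ a) ℤ.- + 2 ℤ.* (h ℤ.+ b) ℤ.- e
  eq₁ = solve-∀

-- Counting descendants by labels.

<-summand : k + suc h ≡ n → k < n
<-summand {k} {h} refl = m<m+n k z<s

descendants : Word n → ℕ → ℤ
descendants     w zero    = 1ℤ
descendants {n} w (suc m) =
  ∑ (λ b → descendants (b ◂ w) m) (filter (site? w) (range 0 (suc n)))

mutual

  -- Induction on `m`, each transition supplying one summand of the recurrence. `Inner` and `Split`
  -- words lead only to each other and to themselves, so `Final` and increasing words can be treated
  -- afterwards.
  descendants-inner : ∀ m {w : Word n} → Standard w → Inner w k → k + suc h ≡ n →
                      descendants w m ≡ inner h m
  descendants-inner {h = h} zero _ _ _ = sym (cong (λ x → x ℤ.- 0ℤ) (s-zero h))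
  descendants-inner {k = zero} (suc m) _ I _ with Inner.low-first I
  ... | _ , () , _
  descendants-inner {n} {suc k} {h} (suc m) {w} st I eq = begin
    descendants w (suc m)
      ≡⟨ ∑-sites f (Inner.sites I) eq ⟩
    f 0 ℤ.+ (∑ f (range (suc k) (suc h)) ℤ.+ f n)
      ≡⟨ cong₂ ℤ._+_
           (descendants-inner m (standard-◂ st z≤n) (inner-prepend-0 st I k<n) (cong suc eq))
           (cong₂ ℤ._+_
             (∑-range-reverse f (λ h → inner h m) (suc k) (suc h) n eq λ {b} k≤b eq′ →
               descendants-inner m (standard-◂ st (m+n≤o⇒m≤o b (≤-reflexive eq′)))
                 (inner-prepend st I k<n k≤b (<-summand eq′)) (cong suc eq′))
             (descendants-split m (standard-◂ st ≤-refl) (inner-prepend-n st I k<n)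
               (+-identityʳ n) (+-comm n 1))) ⟩
    inner h m ℤ.+ (∑ (λ h → inner h m) (downFrom (suc h)) ℤ.+ split 0 0 m)
      ≡⟨ inner-rec h m ⟩
    inner h (suc m) ∎
    where
    open ≡-Reasoning
    f = λ b → descendants (b ◂ w) m
    k<n = <-summand eq

  descendants-split : ∀ m {w : Word n} → Standard w → Split w k l → k + d ≡ l → l + suc j ≡ n →
                      descendants w m ≡ split d j m
  descendants-split {d = d} {j} zero _ _ _ _ = sym (cong₂ ℤ._+_ (s-zero j) (ℤ.*-zeroʳ (+ d ℤ.- 1ℤ)))
  descendants-split {k = zero} (suc m) _ P _ _ with Split.1≤k₀ P
  ... | ()
  descendants-split {n} {suc k} {l} {d} {j} (suc m) {w} st P eq eq′ = begin
    descendants w (suc m)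
      ≡⟨ ∑-sites f (Split.sites P)
           (trans (sym (+-assoc (suc k) d (suc j))) (trans (cong (_+ suc j) eq) eq′)) ⟩
    f 0 ℤ.+ (∑ f (range (suc k) (d + suc j)) ℤ.+ f n)
      -- The middle sites are cut at `l`: `d` letters below, then `l`, then `j` letters above.
      ≡⟨ cong (λ xs → f 0 ℤ.+ (∑ f xs ℤ.+ f n)) (range-++ (suc k) d (suc j)) ⟩
    f 0 ℤ.+ (∑ f (range (suc k) d ++ range (suc k + d) (suc j)) ℤ.+ f n)
      ≡⟨ cong (λ x → f 0 ℤ.+ (x ℤ.+ f n)) (∑-++ f (range (suc k) d) _) ⟩
    f 0 ℤ.+ ((∑ f (range (suc k) d) ℤ.+ ∑ f (range (suc k + d) (suc j))) ℤ.+ f n)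
      ≡⟨ cong (λ l → f 0 ℤ.+ ((∑ f (range (suc k) d) ℤ.+ ∑ f (range l (suc j))) ℤ.+ f n)) eq ⟩
    f 0 ℤ.+ ((∑ f (range (suc k) d) ℤ.+ (f l ℤ.+ ∑ f (range (suc l) j))) ℤ.+ f n)
      ≡⟨ cong₂ ℤ._+_ (low (inj₁ refl) (≤-trans (Split.1≤k₀ P) (Split.k₀≤l P)))
           (cong₂ ℤ._+_
             (cong₂ ℤ._+_
               (∑-range-const f (inner j m) (suc k) d λ {b} k≤b lt → low (inj₂ k≤b) (subst (b <_) eq lt))
               (cong₂ ℤ._+_
                 (descendants-split m (standard-◂ st (<⇒≤ l<n)) (split-prepend-l st P l<n)
                   eq (trans (+-suc l (suc j)) (cong suc eq′)))
                 (∑-range-reverse f (λ h → inner h m) (suc l) j n (trans (sym (+-suc l j)) eq′)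
                   λ {b} l<b eq″ → descendants-inner m (standard-◂ st (m+n≤o⇒m≤o b (≤-reflexive eq″)))
                     (split-prepend-top st P l<n l<b (<-summand eq″)) (cong suc eq″))))
             (descendants-split m (standard-◂ st ≤-refl) (split-prepend-n st P l<n)
               (+-identityʳ n) (+-comm n 1))) ⟩
    inner j m ℤ.+ ((+ d ℤ.* inner j m ℤ.+
    (split d (suc j) m ℤ.+ ∑ (λ h → inner h m) (downFrom j))) ℤ.+ split 0 0 m)
      ≡⟨ split-rec d j m ⟩
    split d j (suc m) ∎
    where
    open ≡-Reasoning
    f = λ b → descendants (b ◂ w) m
    l<n = <-summand eq′
    low : b ≡ 0 ⊎ suc k ≤ b → b < l → f b ≡ inner j m
    low c b<l = descendants-inner m (standard-◂ st (<⇒≤ (<-trans b<l l<n)))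
      (split-prepend-low st P l<n c b<l) (cong suc eq′)

descendants-final : ∀ m {w : Word n} → Standard w → Final w k → k + suc h ≡ n →
                    descendants w m ≡ final h m
descendants-final {h = h} zero _ _ _ = sym (cong (λ x → x ℤ.- 0ℤ) (s-zero h))
descendants-final {k = zero} (suc m) _ E _ with Final.2≤k₀ E
... | ()
descendants-final {n} {suc k} {h} (suc m) {w} st E eq = begin
  descendants w (suc m)
    ≡⟨ ∑-sites f (Final.sites E) eq ⟩
  f 0 ℤ.+ (∑ f (range (suc k) (suc h)) ℤ.+ f n)
    ≡⟨ cong₂ ℤ._+_
         (descendants-final m (standard-◂ st z≤n) (final-prepend-0 st E k<n) (cong suc eq))
         (cong₂ ℤ._+_
           (∑-range-reverse f (λ h → final h m) (suc k) (suc h) n eq λ {b} k≤b eq′ →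
             descendants-final m (standard-◂ st (m+n≤o⇒m≤o b (≤-reflexive eq′)))
               (final-prepend st E k<n k≤b (<-summand eq′)) (cong suc eq′))
           (descendants-split m (standard-◂ st ≤-refl) (final-prepend-n st E k<n)
             eq (+-comm n 1))) ⟩
  final h m ℤ.+ (∑ (λ h → final h m) (downFrom (suc h)) ℤ.+ split (suc h) 0 m)
    ≡⟨ final-rec h m ⟩
  final h (suc m) ∎
  where
  open ≡-Reasoning
  f = λ b → descendants (b ◂ w) m
  k<n = <-summand eq

descendants-identity : ∀ m {w : Word (suc k)} → Standard w → Increasing w 0 →
                       descendants w m ≡ identity k m
descendants-identity {k} zero _ _ = refl
descendants-identity {k} (suc m) {w} st inc = begin
  descendants w (suc m)
    ≡⟨ ∑-sites f (increasing-sites st inc) refl ⟩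
  f 0 ℤ.+ (∑ f (range 1 k) ℤ.+ f (suc k))
    ≡⟨ cong₂ ℤ._+_
         (descendants-identity m (standard-◂ st z≤n) (increasing-prepend-0 st inc))
         (cong₂ ℤ._+_
           (∑-range-reverse f (λ h → final h m) 1 k (suc k) refl λ {b} 1≤b eq →
             descendants-final m (standard-◂ st (m+n≤o⇒m≤o b (≤-reflexive eq)))
               (increasing-prepend st inc 1≤b (<-summand eq)) (cong suc eq))
           (descendants-split m (standard-◂ st ≤-refl) (increasing-prepend-n st inc z<s)
             refl (+-comm (suc k) 1))) ⟩
  identity (suc k) m ℤ.+ (∑ (λ h → final h m) (downFrom k) ℤ.+ split k 0 m)
    ≡⟨ identity-rec k m ⟩
  identity k (suc m) ∎
  where
  open ≡-Reasoning
  f = λ b → descendants (b ◂ w) m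

-- The list of all avoiding words.

words : ∀ n → List (Word n)
words zero    = (λ ()) ∷ []
words (suc n) = concatMap (λ w → map (_◂ w) (filter (site? w) (range 0 (suc n)))) (words n)

-- Each unfolding of `descendants` is absorbed by one `concatMap` level of `words`.
∑-words : ∀ k m → ∑ (λ w → descendants w m) (words k) ≡ + length (words (m + k))
∑-words k zero    = ∑-1 (words k)
∑-words k (suc m) = begin
  ∑ (λ w → descendants w (suc m)) (words k)
    ≡⟨ ∑-cong {f = λ w → descendants w (suc m)}
         (λ w → sym (∑-map (λ v → descendants v m) (_◂ w) (filter (site? w) (range 0 (suc k))))) (words k) ⟩
  ∑ (λ w → ∑ (λ v → descendants v m) (map (_◂ w) (filter (site? w) (range 0 (suc k))))) (words k)
    ≡⟨ ∑-concatMap _ _ (words k) ⟨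
  ∑ (λ v → descendants v m) (words (suc k))
    ≡⟨ ∑-words (suc k) m ⟩
  + length (words (m + suc k))
    ≡⟨ cong (λ l → + length (words l)) (+-suc m k) ⟩
  + length (words (suc m + k)) ∎
  where open ≡-Reasoning

-- The count starts from the one-letter word, which is increasing; this causes the shift of the
-- index by one.
length-words : ∀ m → + length (words (suc m)) ≡ identity 0 m
length-words m = begin
  + length (words (suc m))           ≡⟨ cong (λ l → + length (words l)) (+-comm 1 m) ⟩
  + length (words (m + 1))           ≡⟨ ∑-words 1 m ⟨
  descendants (0 ◂ λ ()) m ℤ.+ 0ℤ    ≡⟨ ℤ.+-identityʳ _ ⟩
  descendants (0 ◂ λ ()) m           ≡⟨ descendants-identity m standard inc ⟩
  identity 0 m                       ∎
  where
  open ≡-Reasoning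
  standard : Standard (0 ◂ λ ())
  standard = standard-◂ standard-empty z≤n
  inc : Increasing (0 ◂ λ ()) 0
  inc zero zero _ ()

_#_ : Word n → Word n → Set
w # w′ = ¬ w ≗ w′

-- Siblings differ in the first letter. Children of different words with the same first letter
-- differ because `bump` is injective.
words-distinct : ∀ n → AllPairs _#_ (words n)
words-distinct zero    = [] ∷ []
words-distinct (suc n) = AllPairs.concat⁺
  (All.map⁺ (All.universal
    (λ w → AllPairs.map⁺ (AllPairs.map (λ b≢b′ eq → b≢b′ (eq zero))
                                       (AllPairs.filter⁺ (site? w) (range-unique 0 (suc n)))))
    (words n)))
  (AllPairs.map⁺ (AllPairs.map
    (λ w#w′ → All.map⁺ (All.universal (λ b → All.map⁺ (All.universal (λ b′ → apart w#w′) _)) _))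
    (words-distinct n)))
  where
  apart : {w w′ : Word n} → w # w′ → (b ◂ w) # (k ◂ w′)
  apart {b} w#w′ eq = w#w′ λ i →
    bump-injective b (trans (eq (suc i)) (cong (λ c → bump c _) (sym (eq zero))))

words-sound : ∀ n → All (λ w → Standard w × Avoiding w) (words n)
words-sound zero    =
  (standard-empty , λ ()) ∷ []
words-sound (suc n) = All.concat⁺ (All.map⁺ (All.map
  (λ { {w} (st , av) → All.map⁺ (All.map
    (λ { ((_ , b<1+n) , g) → standard-◂ st (s≤s⁻¹ b<1+n) , avoiding-◂ av g })
    (All.zip (All.filter⁺ (site? w) (∈-range⁻ 0 (suc n)) , All.all-filter (site? w) _))) })
  (words-sound n)))

avoiding-resp : {w w′ : Word n} → w ≗ w′ → Avoiding w → Avoiding w′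
avoiding-resp eq av i p q r i<p i<q i<r p<i i<q′ q<r = av i p q r i<p i<q i<r
  (subst₂ _<_ (sym (eq p)) (sym (eq i)) p<i)
  (subst₂ _<_ (sym (eq i)) (sym (eq q)) i<q′)
  (subst₂ _<_ (sym (eq q)) (sym (eq r)) q<r)

site-resp : {w w′ : Word n} → w ≗ w′ → Site w k → Site w′ k
site-resp eq g p q r p<k k≤q q<r = g p q r
  (subst (_< _) (sym (eq p)) p<k)
  (subst (_ ≤_) (sym (eq q)) k≤q)
  (subst₂ _<_ (sym (eq q)) (sym (eq r)) q<r)

-- By injectivity the later letters differ from the first, so `unbump` strips it off and the
-- induction applies to the remaining word.
words-complete : ∀ n (w : Word n) → (∀ i → w i < n) → Injective _≡_ _≡_ w → Avoiding w →
                 Any (w ≗_) (words n)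
words-complete zero    w _  _   _  = here λ ()
words-complete (suc n) w bd inj av =
  Any.concatMap⁺ _ (Any.map (λ {u′} u≗u′ → Any.map⁺ (lose
      (∈-filter⁺ (site? u′) (∈-range⁺ z≤n (bd zero)) (site-resp u≗u′ (proj₂ split-av)))
      λ { zero → refl ; (suc i) → trans (w≗c◂u (suc i)) (cong (bump c) (u≗u′ i)) }))
    (words-complete n u
      (λ i → bump-<⁻¹ (above (s≤s⁻¹ (bd zero))) (subst (_< suc n) (w≗c◂u (suc i)) (bd (suc i))))
      (λ {i} {j} eq → Fin.suc-injective (inj
        (trans (w≗c◂u (suc i)) (trans (cong (bump c) eq) (sym (w≗c◂u (suc j)))))))
      (proj₁ split-av)))
  where
  c = w zero
  tail : ∀ i → ∃ λ v → bump c v ≡ w (suc i)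
  tail i = unbump c (w (suc i)) λ eq → Fin.0≢1+n (inj (sym eq))
  u = proj₁ ∘ tail
  w≗c◂u : w ≗ c ◂ u
  w≗c◂u zero    = refl
  w≗c◂u (suc i) = sym (proj₂ (tail i))
  split-av = avoiding-◂⁻¹ (avoiding-resp w≗c◂u av)

-- The three patterns and cyclic order.

quad : {P : Fin 4 → Set} → P zero → P (suc zero) → P (suc (suc zero)) → P (suc (suc (suc zero))) →
       ∀ i → P i
quad a b c d zero                   = a
quad a b c d (suc zero)             = b
quad a b c d (suc (suc zero))       = c
quad a b c d (suc (suc (suc zero))) = d

tuple : A → A → A → A → Fin 4 → A
tuple a b c d = quad a b c d

module _ (f : Fin 4 → ℕ) (f0<f1 : f zero < f (suc zero))
         (f1<f2 : f (suc zero) < f (suc (suc zero)))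
         (f2<f3 : f (suc (suc zero)) < f (suc (suc (suc zero)))) where

  quad-increasing : ∀ i j → i Fin.< j → f i < f j
  quad-increasing zero             (suc zero)             _ = f0<f1
  quad-increasing zero             (suc (suc zero))       _ = <-trans f0<f1 f1<f2
  quad-increasing zero             (suc (suc (suc zero))) _ = <-trans f0<f1 (<-trans f1<f2 f2<f3)
  quad-increasing (suc zero)       (suc zero)             (s≤s ())
  quad-increasing (suc zero)       (suc (suc zero))       _ = f1<f2
  quad-increasing (suc zero)       (suc (suc (suc zero))) _ = <-trans f1<f2 f2<f3
  quad-increasing (suc (suc i))    (suc zero)             (s≤s ())
  quad-increasing (suc (suc zero)) (suc (suc zero))       (s≤s (s≤s ()))
  quad-increasing (suc (suc zero)) (suc (suc (suc zero))) _ = f2<f3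
  quad-increasing (suc (suc (suc zero))) (suc (suc zero)) (s≤s (s≤s ()))
  quad-increasing (suc (suc (suc zero))) (suc (suc (suc zero))) (s≤s (s≤s (s≤s ())))

  quad-cancel : ∀ i j → f i < f j → i Fin.< j
  quad-cancel i j lt with Fin.<-cmp i j
  ... | tri< i<j _ _  = i<j
  ... | tri≈ _ refl _ = contradiction lt (<-irrefl refl)
  ... | tri> _ _ j<i  = contradiction lt (<-asym (quad-increasing j i j<i))

  -- Both sequences are increasing functions of the same ranks `σ i`, so comparing entries amounts
  -- to comparing ranks.
  quad-orderIsomorphic : ∀ {u v : Fin 4 → ℕ} (σ : Fin 4 → Fin 4) →
    (∀ i → u i ≡ f (σ i)) → (∀ i → v i ≡ suc (toℕ (σ i))) → OrderIsomorphic u v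
  quad-orderIsomorphic σ u≗ v≗ i j = mk⇔
    (λ lt → subst₂ _<_ (sym (v≗ i)) (sym (v≗ j))
      (s<s (quad-cancel (σ i) (σ j) (subst₂ _<_ (u≗ i) (u≗ j) lt))))
    (λ lt → subst₂ _<_ (sym (u≗ i)) (sym (u≗ j))
      (quad-increasing (σ i) (σ j) (s<s⁻¹ (subst₂ _<_ (v≗ i) (v≗ j) lt))))

patterns : List Pattern
patterns = (2 ∷ 1 ∷ 4 ∷ 3 ∷ []) ∷ (2 ∷ 3 ∷ 1 ∷ 4 ∷ []) ∷ (2 ∷ 4 ∷ 3 ∷ 1 ∷ []) ∷ []

module _ {π : Fin n → Fin n} where

  private
    w : Word n
    w = toℕ ∘ π

    0F 1F 2F 3F : Fin 4
    0F = zero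
    1F = suc zero
    2F = suc (suc zero)
    3F = suc (suc (suc zero))

  module _ {i p q r : Fin n} (w< : w p < w i) (w<′ : w i < w q) (w<″ : w q < w r) where

    private
      increasing : ∀ {a b c d : Fin n} → a Fin.< b → b Fin.< c → c Fin.< d →
                   tuple a b c d Preserves Fin._<_ ⟶ Fin._<_
      increasing {a} {b} {c} {d} a<b b<c c<d {x} {y} =
        quad-increasing (toℕ ∘ tuple a b c d) a<b b<c c<d x y

      orderIsomorphic : ∀ {u v : Fin 4 → ℕ} (σ : Fin 4 → Fin 4) →
        (∀ i′ → u i′ ≡ w (tuple p i q r (σ i′))) → (∀ i → v i ≡ suc (toℕ (σ i))) →
        OrderIsomorphic u v
      orderIsomorphic = quad-orderIsomorphic (w ∘ tuple p i q r) w< w<′ w<″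

    contains-2143 : i Fin.< p → p Fin.< r → r Fin.< q → Contains (2 ∷ 1 ∷ 4 ∷ 3 ∷ []) π
    contains-2143 i<p p<r r<q = tuple i p r q , increasing i<p p<r r<q ,
      orderIsomorphic (tuple 1F 0F 3F 2F) (quad refl refl refl refl) (quad refl refl refl refl)

    contains-2314 : i Fin.< q → q Fin.< p → p Fin.< r → Contains (2 ∷ 3 ∷ 1 ∷ 4 ∷ []) π
    contains-2314 i<q q<p p<r = tuple i q p r , increasing i<q q<p p<r ,
      orderIsomorphic (tuple 1F 2F 0F 3F) (quad refl refl refl refl) (quad refl refl refl refl)

    contains-2431 : i Fin.< r → r Fin.< q → q Fin.< p → Contains (2 ∷ 4 ∷ 3 ∷ 1 ∷ []) π
    contains-2431 i<r r<q q<p = tuple i r q p , increasing i<r r<q q<p ,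
      orderIsomorphic (tuple 1F 3F 2F 0F) (quad refl refl refl refl) (quad refl refl refl refl)

  -- Of the six orders of three distinct positions, three are cyclic and each of the other three is
  -- one of the patterns.
  S⇒avoiding : S n patterns π → Avoiding w
  S⇒avoiding (_ , ¬2143 ∷ ¬2314 ∷ ¬2431 ∷ []) i p q r i<p i<q i<r p<i i<q′ q<r′
    with Fin.<-cmp p q | Fin.<-cmp q r | Fin.<-cmp p r
  ... | tri≈ _ refl _ | _ | _ = contradiction p<i (<-asym i<q′)
  ... | _ | tri≈ _ refl _ | _ = contradiction q<r′ (<-irrefl refl)
  ... | _ | _ | tri≈ _ refl _ = contradiction p<i (<-asym (<-trans i<q′ q<r′))
  ... | tri< p<q _ _ | tri< q<r _ _ | _ = inj₁ (p<q , q<r)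
  ... | tri< p<q _ _ | tri> _ _ r<q | tri> _ _ r<p = inj₂ (inj₂ (r<p , p<q))
  ... | tri> _ _ q<p | tri< q<r _ _ | tri> _ _ r<p = inj₂ (inj₁ (q<r , r<p))
  ... | tri< p<q _ _ | tri> _ _ r<q | tri< p<r _ _ =
    contradiction (contains-2143 p<i i<q′ q<r′ i<p p<r r<q) ¬2143
  ... | tri> _ _ q<p | tri< q<r _ _ | tri< p<r _ _ =
    contradiction (contains-2314 p<i i<q′ q<r′ i<q q<p p<r) ¬2314
  ... | tri> _ _ q<p | tri> _ _ r<q | _ =
    contradiction (contains-2431 p<i i<q′ q<r′ i<r r<q q<p) ¬2431

  private
    rotate : {p q r : Fin n} → CyclicallyOrdered p q r → CyclicallyOrdered q r p
    rotate (inj₁ (p<q , q<r))        = inj₂ (inj₂ (p<q , q<r))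
    rotate (inj₂ (inj₁ (q<r , r<p))) = inj₁ (q<r , r<p)
    rotate (inj₂ (inj₂ (r<p , p<q))) = inj₂ (inj₁ (r<p , p<q))

    ¬odd : {p q r : Fin n} → p Fin.< q → q Fin.< r → ¬ CyclicallyOrdered p r q
    ¬odd p<q q<r (inj₁ (_ , r<q))        = <-asym q<r r<q
    ¬odd p<q q<r (inj₂ (inj₁ (r<q , _))) = <-asym q<r r<q
    ¬odd p<q q<r (inj₂ (inj₂ (q<p , _))) = <-asym p<q q<p

    0<1 : 0F Fin.< 1F
    0<1 = z<s
    1<2 : 1F Fin.< 2F
    1<2 = s<s z<s
    2<3 : 2F Fin.< 3F
    2<3 = s<s (s<s z<s)

  -- Up to rotation, each of the three patterns would put the last three positions of its occurrence
  -- in the cyclic order first, third, second, which `¬odd` refutes.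
  avoiding⇒S : Standard w → Avoiding w → S n patterns π
  avoiding⇒S st av =
    ((λ eq → injective st (cong toℕ eq)) ,
     strictlySurjective⇒surjective λ y → let x , eq = surjective st (Fin.toℕ<n y) in
       x , Fin.toℕ-injective eq) ,
    (λ { (ι , inc , iso) → ¬odd (inc 1<2) (inc 2<3)
       (av (ι 0F) (ι 1F) (ι 3F) (ι 2F)
         (inc 0<1) (inc (<-trans 0<1 (<-trans 1<2 2<3))) (inc (<-trans 0<1 1<2))
         (from (iso 1F 0F) (s<s z<s)) (from (iso 0F 3F) (s<s (s<s z<s)))
         (from (iso 3F 2F) (s<s (s<s (s<s z<s))))) }) ∷
    (λ { (ι , inc , iso) → ¬odd (inc 1<2) (inc 2<3) (rotate
       (av (ι 0F) (ι 2F) (ι 1F) (ι 3F)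
         (inc (<-trans 0<1 1<2)) (inc 0<1) (inc (<-trans 0<1 (<-trans 1<2 2<3)))
         (from (iso 2F 0F) (s<s z<s)) (from (iso 0F 1F) (s<s (s<s z<s)))
         (from (iso 1F 3F) (s<s (s<s (s<s z<s)))))) }) ∷
    (λ { (ι , inc , iso) → ¬odd (inc 1<2) (inc 2<3) (rotate (rotate
       (av (ι 0F) (ι 3F) (ι 2F) (ι 1F)
         (inc (<-trans 0<1 (<-trans 1<2 2<3))) (inc (<-trans 0<1 1<2)) (inc 0<1)
         (from (iso 3F 0F) (s<s z<s)) (from (iso 0F 2F) (s<s (s<s z<s)))
         (from (iso 2F 1F) (s<s (s<s (s<s z<s))))))) }) ∷
    []
    where open Equivalence using (from)

-- Counting permutations by words.

standard-resp : {w w′ : Word n} → w ≗ w′ → Standard w → Standard w′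
standard-resp eq st = record
  { bounded    = λ i → subst (_< _) (eq i) (bounded st i)
  ; injective  = λ {i} {j} eq′ → injective st (trans (eq i) (trans eq′ (sym (eq j))))
  ; surjective = λ v<n → let i , eq′ = surjective st v<n in i , trans (sym (eq i)) eq′ }

Any-─ : {P Q : A → Set} {xs : List A} (x∈xs : Any P xs) → (∀ {x} → P x → ¬ Q x) →
        Any Q xs → Any Q (xs ─ x∈xs)
Any-─ (here px)    P⇒¬Q (here qx)    = contradiction qx (P⇒¬Q px)
Any-─ (here px)    P⇒¬Q (there q∈xs) = q∈xs
Any-─ (there p∈xs) P⇒¬Q (here qx)    = here qx
Any-─ (there p∈xs) P⇒¬Q (there q∈xs) = there (Any-─ p∈xs P⇒¬Q q∈xs)

-- A pigeonhole principle for relations: the partner of the first entry is removed from `ys`, and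
-- the other entries keep theirs since no partner is shared.
length-≤ : (R : A → B → Set) {xs : List A} (ys : List B) →
           AllPairs (λ x x′ → ∀ y → R x y → ¬ R x′ y) xs →
           All (λ x → Any (R x) ys) xs → length xs ≤ length ys
length-≤ R ys []             []              = z≤n
length-≤ R {x ∷ xs} ys (x#xs ∷ xs#xs) (Rx ∷ Rxs) = ≤-trans
  (s≤s (length-≤ R (ys ─ Rx) xs#xs
    (All.zipWith (λ { {x′} (x#x′ , Rx′) → Any-─ {P = R x} {Q = R x′} Rx (x#x′ _) Rx′ }) (x#xs , Rxs))))
  (≤-reflexive (sym (length-removeAt′ ys (index Rx))))

-- Functions are only compared pointwise, so no bijection of lists is built; the relation `∼` bounds
-- each length by the other.
∣S∣≡length-words : ∀ n → ∣S∣ n patterns ≡ length (words n)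
∣S∣≡length-words n = ≤-antisym
  (length-≤ _∼_ (words n)
    (AllPairs.map (λ x≢x′ w x∼w x′∼w → x≢x′ (finToFun-injective λ i →
                     Fin.toℕ-injective (trans (x∼w i) (sym (x′∼w i)))))
                  (AllPairs.filter⁺ (S? n patterns ∘ finToFun) (Unique.allFin⁺ (n ^ n))))
    (All.map (λ s → words-complete n _ (λ i → Fin.toℕ<n _)
                      (λ eq → proj₁ (proj₁ s) (Fin.toℕ-injective eq)) (S⇒avoiding s))
             (All.all-filter (S? n patterns ∘ finToFun) (allFin (n ^ n)))))
  (length-≤ (λ w x → x ∼ w) _
    (AllPairs.map (λ w#w′ x x∼w x∼w′ → w#w′ λ i → trans (sym (x∼w i)) (x∼w′ i)) (words-distinct n))
    (All.map (λ { {w} (st , av) →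
        let π     = λ i → Fin.fromℕ< (bounded st i)
            x∼w   = λ i → trans (cong toℕ (Fin.finToFun-funToFin π i)) (Fin.toℕ-fromℕ< (bounded st i))
            w≗x   = sym ∘ x∼w
        in lose (∈-filter⁺ (S? n patterns ∘ finToFun) (∈-allFin (funToFin π))
                           (avoiding⇒S (standard-resp w≗x st) (avoiding-resp w≗x av)))
                x∼w })
      (words-sound n)))
  where
  _∼_ : Fin (n ^ n) → Word n → Set
  x ∼ w = toℕ ∘ finToFun {n} {n} x ≗ w
  funToFin-cong : ∀ {k} {f g : Fin k → Fin n} → f ≗ g → funToFin f ≡ funToFin g
  funToFin-cong {zero}  f≗g = refl
  funToFin-cong {suc k} f≗g = cong₂ Fin.combine (f≗g zero) (funToFin-cong (f≗g ∘ suc))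
  finToFun-injective : ∀ {x y} → finToFun {n} {n} x ≗ finToFun y → x ≡ y
  finToFun-injective {x} {y} eq = begin
    x                             ≡⟨ Fin.funToFin-finToFin {n} {n} x ⟨
    funToFin {n} {n} (finToFun x) ≡⟨ funToFin-cong eq ⟩
    funToFin {n} {n} (finToFun y) ≡⟨ Fin.funToFin-finToFin {n} {n} y ⟩
    y                             ∎
    where open ≡-Reasoning

-- The rational generating function.

t0-suc : ∀ m → t 0 (2 + m) ≡ + 3 ℤ.* t 0 (1 + m) ℤ.- t 0 m ℤ.+ (s 0 (2 + m) ℤ.- + 2 ℤ.* s 0 (1 + m))
t0-suc m = begin
  s 0 (2 + m) ℤ.+ t 1 (1 + m)
    -- Eliminating `t 1` from `t 0 = s 0 + x t 1` and `(1 − 2x) t 1 = (1 − x) t 0` gives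
    -- `(1 − 3x + x²) t 0 = (1 − 2x) s 0`.
    ≡⟨ cong (ℤ._+_ (s 0 (2 + m))) (t-suc 0 (1 + m)) ⟩
  s 0 (2 + m) ℤ.+ (+ 2 ℤ.* t 1 m ℤ.+ (t 0 (1 + m) ℤ.- t 0 m))
    ≡⟨ eq (s 0 (2 + m)) (s 0 (1 + m)) (t 0 m) (t 1 m) ⟩
  + 3 ℤ.* t 0 (1 + m) ℤ.- t 0 m ℤ.+ (s 0 (2 + m) ℤ.- + 2 ℤ.* s 0 (1 + m)) ∎
  where
  open ≡-Reasoning
  eq : ∀ a b c d → a ℤ.+ (+ 2 ℤ.* d ℤ.+ (b ℤ.+ d ℤ.- c)) ≡ + 3 ℤ.* (b ℤ.+ d) ℤ.- c ℤ.+ (a ℤ.- + 2 ℤ.* b)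
  eq = solve-∀

-- The factor 1 − 3x + x² of the denominator turns identity 0 into a
-- combination of shifts of s 0, which the factor 1 − 4x + 2x² annihilates.
identity-step : ∀ n → identity 0 (3 + n) ≡
  + 3 ℤ.* identity 0 (2 + n) ℤ.- identity 0 (1 + n) ℤ.+ (s 0 (1 + n) ℤ.+ s 0 n)
identity-step n = eq (t0-suc (1 + n)) (t0-suc n) refl refl
  where
  rearrange : ∀ t₀ t₁ s₀ s₁ →
    (+ 3 ℤ.* (+ 3 ℤ.* t₁ ℤ.- t₀ ℤ.+ (+ 4 ℤ.* s₁ ℤ.- + 2 ℤ.* s₀ ℤ.- + 2 ℤ.* s₁)) ℤ.- t₁
      ℤ.+ (+ 4 ℤ.* (+ 4 ℤ.* s₁ ℤ.- + 2 ℤ.* s₀) ℤ.- + 2 ℤ.* s₁ ℤ.- + 2 ℤ.* (+ 4 ℤ.* s₁ ℤ.- + 2 ℤ.* s₀)))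
      ℤ.- + 2 ℤ.* (+ 3 ℤ.* t₁ ℤ.- t₀ ℤ.+ (+ 4 ℤ.* s₁ ℤ.- + 2 ℤ.* s₀ ℤ.- + 2 ℤ.* s₁))
      ℤ.- (+ 4 ℤ.* s₁ ℤ.- + 2 ℤ.* s₀) ≡
    + 3 ℤ.* ((+ 3 ℤ.* t₁ ℤ.- t₀ ℤ.+ (+ 4 ℤ.* s₁ ℤ.- + 2 ℤ.* s₀ ℤ.- + 2 ℤ.* s₁)) ℤ.- + 2 ℤ.* t₁ ℤ.- s₁)
      ℤ.- (t₁ ℤ.- + 2 ℤ.* t₀ ℤ.- s₀) ℤ.+ (s₁ ℤ.+ s₀)
  rearrange = solve-∀
  eq : ∀ {t₀ t₁ t₂ t₃ s₀ s₁ s₂ s₃} →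
    t₃ ≡ + 3 ℤ.* t₂ ℤ.- t₁ ℤ.+ (s₃ ℤ.- + 2 ℤ.* s₂) →
    t₂ ≡ + 3 ℤ.* t₁ ℤ.- t₀ ℤ.+ (s₂ ℤ.- + 2 ℤ.* s₁) →
    s₃ ≡ + 4 ℤ.* s₂ ℤ.- + 2 ℤ.* s₁ → s₂ ≡ + 4 ℤ.* s₁ ℤ.- + 2 ℤ.* s₀ →
    t₃ ℤ.- + 2 ℤ.* t₂ ℤ.- s₂ ≡
      + 3 ℤ.* (t₂ ℤ.- + 2 ℤ.* t₁ ℤ.- s₁) ℤ.- (t₁ ℤ.- + 2 ℤ.* t₀ ℤ.- s₀) ℤ.+ (s₁ ℤ.+ s₀)
  eq {t₀} {t₁} {s₀ = s₀} {s₁} refl refl refl refl = rearrange t₀ t₁ s₀ s₁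

-- The coefficients of `(1 − 3x + x²)(1 − 4x + 2x²)`, nested and closed with `0ℤ` as repeated use of
-- `polynomial-∷-*` leaves them.
combination : ℤ → ℤ → ℤ → ℤ → ℤ → ℤ
combination f₅ f₄ f₃ f₂ f₁ =
  + 1 ℤ.* f₅ ℤ.+ (- (+ 7) ℤ.* f₄ ℤ.+ (+ 15 ℤ.* f₃ ℤ.+ (- (+ 10) ℤ.* f₂ ℤ.+ (+ 2 ℤ.* f₁ ℤ.+ 0ℤ))))

identity-recurrence : ∀ n →
  combination (identity 0 (4 + n)) (identity 0 (3 + n)) (identity 0 (2 + n))
              (identity 0 (1 + n)) (identity 0 n) ≡ 0ℤ
-- `identity-step` starts at index 3 and does not reach index 2, so this case is computed.
identity-recurrence zero    = refl
identity-recurrence (suc n) =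
  eq {s₀ = s 0 n} {s 0 (1 + n)} {s 0 (2 + n)} {s 0 (3 + n)}
     (identity-step (2 + n)) (identity-step (1 + n)) (identity-step n) refl refl
  where
  rearrange : ∀ e₁ e₂ s₀ s₁ →
    let s₂ = + 4 ℤ.* s₁ ℤ.- + 2 ℤ.* s₀
        s₃ = + 4 ℤ.* s₂ ℤ.- + 2 ℤ.* s₁
        e₃ = + 3 ℤ.* e₂ ℤ.- e₁ ℤ.+ (s₁ ℤ.+ s₀)
        e₄ = + 3 ℤ.* e₃ ℤ.- e₂ ℤ.+ (s₂ ℤ.+ s₁)
        e₅ = + 3 ℤ.* e₄ ℤ.- e₃ ℤ.+ (s₃ ℤ.+ s₂)
    in + 1 ℤ.* e₅ ℤ.+ (- (+ 7) ℤ.* e₄ ℤ.+ (+ 15 ℤ.* e₃ ℤ.+ (- (+ 10) ℤ.* e₂ ℤ.+ (+ 2 ℤ.* e₁ ℤ.+ 0ℤ)))) ≡ 0ℤ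
  rearrange = solve-∀
  eq : ∀ {e₁ e₂ e₃ e₄ e₅ s₀ s₁ s₂ s₃} →
    e₅ ≡ + 3 ℤ.* e₄ ℤ.- e₃ ℤ.+ (s₃ ℤ.+ s₂) →
    e₄ ≡ + 3 ℤ.* e₃ ℤ.- e₂ ℤ.+ (s₂ ℤ.+ s₁) →
    e₃ ≡ + 3 ℤ.* e₂ ℤ.- e₁ ℤ.+ (s₁ ℤ.+ s₀) →
    s₃ ≡ + 4 ℤ.* s₂ ℤ.- + 2 ℤ.* s₁ → s₂ ≡ + 4 ℤ.* s₁ ℤ.- + 2 ℤ.* s₀ →
    combination e₅ e₄ e₃ e₂ e₁ ≡ 0ℤ
  eq {e₁} {e₂} {s₀ = s₀} {s₁} refl refl refl refl refl = rearrange e₁ e₂ s₀ s₁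

polynomial-[]-* : ∀ f → polynomial [] * f ≗ λ _ → 0ℤ
polynomial-[]-* f n = trans (sum-cong-≗ {suc n} (λ i → ℤ.*-zeroˡ (f (toℕ i)))) (sum-replicate-zero (suc n))

-- The sum runs over the index of `f`, so the constant coefficient `a` sits in the last summand; the
-- others form the product with `as`.
polynomial-∷-* : ∀ a as f n → (polynomial (a ∷ as) * f) (suc n) ≡
                 a ℤ.* f (suc n) ℤ.+ (polynomial as * f) n
polynomial-∷-* a as f n = begin
  (polynomial (a ∷ as) * f) (suc n)
    ≡⟨ sum-init-last term ⟩
  ∑[ i ≤ n ] term (Fin.inject₁ i) ℤ.+ term (Fin.fromℕ (suc n))
    ≡⟨ cong₂ ℤ._+_ (sum-cong-≗ {suc n} init-term) last-term ⟩
  (polynomial as * f) n ℤ.+ a ℤ.* f (suc n)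
    ≡⟨ ℤ.+-comm ((polynomial as * f) n) _ ⟩
  a ℤ.* f (suc n) ℤ.+ (polynomial as * f) n ∎
  where
  open ≡-Reasoning
  term : Fin (2 + n) → ℤ
  term i = polynomial (a ∷ as) (suc n ∸ toℕ i) ℤ.* f (toℕ i)
  init-term : ∀ i → term (Fin.inject₁ i) ≡ polynomial as (n ∸ toℕ i) ℤ.* f (toℕ i)
  init-term i rewrite Fin.toℕ-inject₁ i | +-∸-assoc 1 (s≤s⁻¹ (Fin.toℕ<n i)) = refl
  last-term : term (Fin.fromℕ (suc n)) ≡ a ℤ.* f (suc n)
  last-term rewrite Fin.toℕ-fromℕ n | n∸n≡0 n = refl

*-congʳ : ∀ {f g} h → f ≗ g → f * h ≗ g * h
*-congʳ h f≗g n = sum-cong-≗ {suc n} λ i → cong (ℤ._* h (toℕ i)) (f≗g (n ∸ toℕ i))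

denominator : polynomial (+ 1 ∷ - (+ 3) ∷ + 1 ∷ []) * polynomial (+ 1 ∷ - (+ 4) ∷ + 2 ∷ []) ≗
              polynomial (+ 1 ∷ - (+ 7) ∷ + 15 ∷ - (+ 10) ∷ + 2 ∷ [])
denominator 0 = refl
denominator 1 = refl
denominator 2 = refl
denominator 3 = refl
denominator 4 = refl
-- From degree 5 on, every term of the expansion meets a vanishing coefficient of the quadratic
-- factor.
denominator (suc (suc (suc (suc (suc n)))))
  rewrite polynomial-∷-* (+ 1) (- (+ 3) ∷ + 1 ∷ []) (polynomial (+ 1 ∷ - (+ 4) ∷ + 2 ∷ [])) (4 + n)
        | polynomial-∷-* (- (+ 3)) (+ 1 ∷ []) (polynomial (+ 1 ∷ - (+ 4) ∷ + 2 ∷ [])) (3 + n)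
        | polynomial-∷-* (+ 1) [] (polynomial (+ 1 ∷ - (+ 4) ∷ + 2 ∷ [])) (2 + n)
        | polynomial-[]-* (polynomial (+ 1 ∷ - (+ 4) ∷ + 2 ∷ [])) (1 + n) = refl

count : ℕ → ℤ
count zero    = 1ℤ
count (suc m) = identity 0 m

F≗count : F patterns ≗ count
F≗count zero    = cong +_ (∣S∣≡length-words 0)
F≗count (suc m) = trans (cong +_ (∣S∣≡length-words (suc m))) (length-words m)

denominator*count : polynomial (+ 1 ∷ - (+ 7) ∷ + 15 ∷ - (+ 10) ∷ + 2 ∷ []) * count ≗
                    polynomial (+ 1 ∷ - (+ 6) ∷ + 10 ∷ - (+ 3) ∷ + 1 ∷ [])
denominator*count 0 = refl
denominator*count 1 = refl
denominator*count 2 = refl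
denominator*count 3 = refl
denominator*count 4 = refl
-- From degree 5 on, only positive indices of `count` occur, where it is a shift of `identity 0`.
denominator*count (suc (suc (suc (suc (suc n))))) =
  trans (expand count) (identity-recurrence n)
  where
  expand : ∀ f → (polynomial (+ 1 ∷ - (+ 7) ∷ + 15 ∷ - (+ 10) ∷ + 2 ∷ []) * f) (5 + n) ≡
           combination (f (5 + n)) (f (4 + n)) (f (3 + n)) (f (2 + n)) (f (1 + n))
  expand f
    rewrite polynomial-∷-* (+ 1) (- (+ 7) ∷ + 15 ∷ - (+ 10) ∷ + 2 ∷ []) f (4 + n)
          | polynomial-∷-* (- (+ 7)) (+ 15 ∷ - (+ 10) ∷ + 2 ∷ []) f (3 + n)
          | polynomial-∷-* (+ 15) (- (+ 10) ∷ + 2 ∷ []) f (2 + n)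
          | polynomial-∷-* (- (+ 10)) (+ 2 ∷ []) f (1 + n)
          | polynomial-∷-* (+ 2) [] f n
          | polynomial-[]-* f n = refl

theorem21 : F ((2 ∷ 1 ∷ 4 ∷ 3 ∷ []) ∷ (2 ∷ 3 ∷ 1 ∷ 4 ∷ []) ∷ (2 ∷ 4 ∷ 3 ∷ 1 ∷ []) ∷ [])
    ≗ polynomial (+ 1 ∷ - (+ 6) ∷ + 10 ∷ - (+ 3) ∷ + 1 ∷ [])
    / (polynomial (+ 1 ∷ - (+ 3) ∷ + 1 ∷ []) * polynomial (+ 1 ∷ - (+ 4) ∷ + 2 ∷ []))
theorem21 n = trans (F≗count n)
  (/-unique _ _ count refl
    (λ k → trans (*-congʳ count denominator k) (denominator*count k)) n)
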